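{- (Right Pieri rule.) Let $A$ be a finite alphabet of colors, let $J=(v_1,\dots,v_h)$ be a sentence and $w$ a word over $A$. Then $$\mathfrak{S}_J\,H_w=\sum_{K}\mathfrak{S}_K,$$ where the sum runs over all sentences $K=(u_1,\dots,u_g)$ with $h\le g\le h+1$ for which there exist (possibly empty) words $q_1,\dots,q_g$ with $u_j=v_j\cdot q_j$ for $1\le j\le g$ (where $v_{h+1}=\emptyset$) and $q_g\cdot q_{g-1}\cdots q_1=w$.
   Context: Words are finite sequences of colors, $\cdot$ denotes concatenation; a sentence is a finite sequence $I=(w_1,\dots,w_k)$ of nonempty words (the empty sentence is $\emptyset$); $\ell(I)=k$; for sentences with the same concatenated word $w_1\cdots w_k$, $Q\preceq S$ means $S$ is obtained from $Q$ by concatenating some adjacent words. Let $x_{a,i}$ ($a\in A$, $i\ge1$) be variables subject only to $x_{a,i}x_{b,j}=x_{b,j}x_{a,i}$ for $i\ne j$; $x_{w,i}=x_{c_1,i}\cdots x_{c_r,i}$ for $w=c_1\cdots c_r$. $M_I=\sum_{j_1<\dots<j_k}x_{w_1,j_1}\cdots x_{w_k,j_k}$, $M_\emptyset=1$; $QSym_A$ is the span of the $M_I$, an algebra under multiplication of power series. $NSym_A$ is the free associative $\mathbb{Q}$-algebra on generators $H_w$, $w$ a nonempty word; $H_I=H_{w_1}\cdots H_{w_k}$, $H_\emptyset=1$; the pairing $\langle\cdot,\cdot\rangle:NSym_A\times QSym_A\to\mathbb{Q}$ is $\langle H_I,M_J\rangle=\delta_{I,J}$. For $M\in QSym_A$,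 the right perp operator $M^{\perp_r}$ on $NSym_A$ is the linear map with $\langle M^{\perp_r}(H),G\rangle=\langle H,GM\rangle$ for all $G\in QSym_A$. For a nonempty word $v$, the colored noncommutative Bernstein operator is $$\mathbb{B}_v(f)=\sum_u\sum_{Q}(-1)^{\ell(Q)}H_{(v\cdot u)}\Big(\sum_{S\succeq Q}M^{\perp_r}_S(f)\Big),$$ where $u$ runs over all words (including the empty word, for which only $Q=\emptyset$ occurs and $M^{\perp_r}_\emptyset$ is the identity), $Q=(q_1,\dots,q_i)$ runs over sentences with $q_i\cdot q_{i-1}\cdots q_1=u$, $S$ over coarsenings of $Q$, and $H_{(v\cdot u)}$ is the generator indexed by the one-word sentence $(v\cdot u)$, multiplied on the left. For a sentence $J=(v_1,\dots,v_h)$ the colored immaculate function is $\mathfrak{S}_J=\mathbb{B}_{v_1}\mathbb{B}_{v_2}\cdots\mathbb{B}_{v_h}(1)$. -}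

module Defs where

open import Data.Nat using (ℕ; zero; suc; _⊔_) renaming (_+_ to _+ℕ_)
open import Data.Fin using (Fin)
open import Data.Fin.Properties using () renaming (_≟_ to _≟F_)
open import Data.List using (List; []; _∷_; _++_; map; concatMap; foldr; filter; reverse; length; upTo; allFin)
open import Data.List.NonEmpty using (List⁺; _∷_; _⁺++_; toList; fromList)
import Data.List.NonEmpty as L⁺
import Data.List.Properties as LP
import Data.Maybe.Properties as MP
open import Data.Maybe using (Maybe; just; nothing)
import Data.Maybe
open import Data.Product using (_×_; _,_)
open import Data.Rational using (ℚ; 0ℚ; 1ℚ; _+_; _*_; -_)
open import Data.List.Relation.Unary.Any using (any?)
open import Relation.Binary.PropositionalEquality using (_≡_; refl; cong₂)
open import Relation.Binary.Definitions using (DecidableEquality)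
open import Relation.Nullary using (yes; no)
open import Relation.Nullary.Decidable using (map′)

module _ {n : ℕ} where

  Color : Set
  Color = Fin n

  Word : Set
  Word = List Color

  NWord : Set
  NWord = List⁺ Color

  Sentence : Set
  Sentence = List NWord

  _≟W⁺_ : DecidableEquality NWord
  (a ∷ as) ≟W⁺ (b ∷ bs) with a ≟F b | LP.≡-dec _≟F_ as bs
  ... | yes refl | yes refl = yes refl
  ... | no a≢b   | _        = no λ { refl → a≢b refl }
  ... | yes _    | no as≢bs = no λ { refl → as≢bs refl }

  _≟S_ : DecidableEquality Sentence
  _≟S_ = LP.≡-dec _≟W⁺_

  ℓ : Sentence → ℕ
  ℓ = length

  size : Sentence → ℕ
  size = foldr (λ w m → L⁺.length w +ℕ m) 0

  -- NSym_A : formal finite ℚ-linear combinations of the basis H_I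
  -- (I a sentence).  An element is a list of (coefficient , I);
  -- two elements are equal iff all coefficients agree.

  NSym : Set
  NSym = List (ℚ × Sentence)

  coeff : NSym → Sentence → ℚ
  coeff []            I = 0ℚ
  coeff ((c , J) ∷ f) I with J ≟S I
  ... | yes _ = c + coeff f I
  ... | no  _ = coeff f I

  _≈ᴺ_ : NSym → NSym → Set
  f ≈ᴺ g = ∀ I → coeff f I ≡ coeff g I

  H : Sentence → NSym
  H I = (1ℚ , I) ∷ []

  oneᴺ : NSym
  oneᴺ = H []

  zeroᴺ : NSym
  zeroᴺ = []

  _+ᴺ_ : NSym → NSym → NSym
  _+ᴺ_ = _++_

  sumᴺ : List NSym → NSym
  sumᴺ = foldr _+ᴺ_ zeroᴺ

  scale : ℚ → NSym → NSym
  scale a = map (λ { (c , I) → (a * c , I) })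

  _*ᴺ_ : NSym → NSym → NSym
  f *ᴺ g = concatMap (λ { (a , I) → map (λ { (b , J) → (a * b , I ++ J) }) g }) f

  -- QSym_A product in the monomial basis.
  -- M_J M_S = Σ_{K ∈ qsh J S} M_K  (as a multiset): the quasi-shuffle
  -- of J and S where, when a word a of J and a word b of S fall on the
  -- same variable index, they merge into x_{a,i} x_{b,i} = x_{a·b,i}.

  qsh : Sentence → Sentence → List Sentence
  qsh []      S       = S ∷ []
  qsh (a ∷ J) []      = (a ∷ J) ∷ []
  qsh (a ∷ J) (b ∷ S) =
       map (a ∷_) (qsh J (b ∷ S))
    ++ map (b ∷_) (qsh (a ∷ J) S)
    ++ map ((a L⁺.⁺++⁺ b) ∷_) (qsh J S)

  countQ : Sentence → List Sentence → ℚ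
  countQ K []       = 0ℚ
  countQ K (L ∷ Ls) with K ≟S L
  ... | yes _ = 1ℚ + countQ K Ls
  ... | no  _ = countQ K Ls

  pairHMM : Sentence → Sentence → Sentence → ℚ
  pairHMM I J S = countQ I (qsh J S)

  sentencesOfSize : ℕ → List Sentence
  sentencesOfSize zero    = [] ∷ []
  sentencesOfSize (suc m) =
    concatMap (λ K → concatMap (λ c → ((c ∷ []) ∷ K) ∷ ext c K) (allFin n))
              (sentencesOfSize m)
    where
      ext : Color → Sentence → List Sentence
      ext c []      = []
      ext c (x ∷ K) = ((c L⁺.∷⁺ x) ∷ K) ∷ []

  sentencesUpTo : ℕ → List Sentence
  sentencesUpTo m = concatMap sentencesOfSize (upTo (suc m))

  wordsOfLength : ℕ → List Word
  wordsOfLength zero    = [] ∷ []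
  wordsOfLength (suc k) = concatMap (λ c → map (c ∷_) (wordsOfLength k)) (allFin n)

  wordsUpTo : ℕ → List Word
  wordsUpTo k = concatMap wordsOfLength (upTo (suc k))

  factorizations : Word → List Sentence
  factorizations []       = [] ∷ []
  factorizations (c ∷ cs) = concatMap step (factorizations cs)
    where
      step : Sentence → List Sentence
      step []      = ((c ∷ []) ∷ []) ∷ []
      step (p ∷ P) = ((c ∷ []) ∷ p ∷ P) ∷ ((c L⁺.∷⁺ p) ∷ P) ∷ []

  coarsenings : Sentence → List Sentence
  coarsenings []      = [] ∷ []
  coarsenings (q ∷ Q) = concatMap step (coarsenings Q)
    where
      step : Sentence → List Sentence
      step []      = (q ∷ []) ∷ []
      step (s ∷ S) = (q ∷ s ∷ S) ∷ ((q L⁺.⁺++⁺ s) ∷ S) ∷ []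

  -- Right perp operator:  ⟨M_S^{⊥r}(H), M_J⟩ = ⟨H, M_J M_S⟩, i.e.
  -- M_S^{⊥r}(H_I) = Σ_J ⟨H_I, M_J M_S⟩ H_J.  Only J with
  -- size J ≤ size I can contribute, so J ranges over sentencesUpTo.

  perpR : Sentence → NSym → NSym
  perpR S f = concatMap
    (λ { (c , I) → map (λ J → (c * pairHMM I J S , J)) (sentencesUpTo (size I)) }) f

  degBound : NSym → ℕ
  degBound = foldr (λ { (_ , I) m → size I ⊔ m }) 0

  sign : ℕ → ℚ
  sign zero    = 1ℚ
  sign (suc k) = - sign k

  -- Colored noncommutative Bernstein operator B_v.
  -- u runs over words, Q = (q_1,…,q_i) over sentences with
  -- q_i ⋯ q_1 = u (i.e. reverse Q is a factorization of u).
  -- Terms with |u| > degBound f vanish (every S ⪰ Q has more letters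
  -- than any I in f, so M_S^{⊥r}(f) = 0), so u ranges over words of
  -- length ≤ degBound f.

  𝔹 : NWord → NSym → NSym
  𝔹 v f = sumᴺ (concatMap
    (λ u → map (λ Q → scale (sign (ℓ Q))
                        (H ((v ⁺++ u) ∷ []) *ᴺ sumᴺ (map (λ S → perpR S f) (coarsenings Q))))
               (map reverse (factorizations u)))
    (wordsUpTo (degBound f)))

  𝔖 : Sentence → NSym
  𝔖 J = foldr 𝔹 oneᴺ J

  splitsInto : ℕ → Word → List (List Word)
  splitsInto zero    []      = [] ∷ []
  splitsInto zero    (_ ∷ _) = []
  splitsInto (suc g) w       = concatMap (λ { (p , s) → map (p ∷_) (splitsInto g s) }) (splits w)
    where
      splits : Word → List (Word × Word)
      splits []       = ([] , []) ∷ []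
      splits (c ∷ cs) = ([] , c ∷ cs) ∷ map (λ { (p , s) → (c ∷ p , s) }) (splits cs)

  qTuples : ℕ → Word → List (List Word)
  qTuples g w = map reverse (splitsInto g w)

  -- given J = (v_1,…,v_h) and (q_1,…,q_g) with g ∈ {h, h+1}, the sentence
  -- (v_1·q_1, …, v_g·q_g) where v_{h+1} = ∅ (nothing if it is not a
  -- sentence, i.e. if v_{h+1}·q_{h+1} is empty, or if g ∉ {h,h+1})
  build : Sentence → List Word → Maybe Sentence
  build []      []           = just []
  build []      (q ∷ [])     = Data.Maybe.map (_∷ []) (fromList q)
  build []      (_ ∷ _ ∷ _)  = nothing
  build (_ ∷ _) []           = nothing
  build (v ∷ J) (q ∷ qs)     = Data.Maybe.map ((v ⁺++ q) ∷_) (build J qs)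

  admissibleQs : Sentence → Word → List (List Word)
  admissibleQs J w = qTuples (ℓ J) w ++ qTuples (suc (ℓ J)) w

  -- all sentences K satisfying the Pieri condition (each exactly once):
  -- every such K has size J + |w| letters, so we filter that finite set.
  pieriIndex : Sentence → NWord → List Sentence
  pieriIndex J w =
    filter (λ K → any? (λ qs → MP.≡-dec _≟S_ (build J qs) (just K))
                       (admissibleQs J (toList w)))
           (sentencesOfSize (size J +ℕ L⁺.length w))

{-# OPTIONS --safe #-}
-- Dually to the product of QSym_A, Δ(H_w) = Σ_{w = x·y} H_x ⊗ H_y is multiplicative, and the
-- signed sum over Q and S ⪰ Q in the Bernstein operator computes ω ∘ S, where S is the antipode of
-- NSym_A and ω the algebra map H_w ↦ w to the free algebra on A. Thus
--   𝔹_v(f) = Σ H_{v·ω(S(f₂))} f₁,   with Δ(f) = Σ f₁ ⊗ f₂.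
-- Since S reverses products, 𝔹_v(f H_x) = Σ_{x = x₁·x₂} H_{v·ω(S(H_{x₂}))·ω(S(f₂))} f₁ H_{x₁}.
-- Summing 𝔹_{v·y}(f H_x) over w = x·y, the antipode identity Σ y·ω(S(H_{x₂})) = 0 kills all terms
-- but x₁ = w, which gives
--   𝔹_v(f) H_w = Σ_{w = x·y} 𝔹_{v·y}(f H_x),
-- and the theorem follows by induction on J. Elements of NSym_A are compared through their values
-- on arbitrary functionals h : Sentence → ℚ, so that every operator is handled by its transpose.

module Submission where

open import Defs
open import Data.Nat using (ℕ; zero; suc; _≤_; s≤s)
import Data.Nat as ℕ
import Data.Nat.Properties as ℕₚ
open import Algebra.Properties.CommutativeSemigroup ℕₚ.+-commutativeSemigroup using (interchange)
open import Data.Fin using (Fin)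
open import Data.Fin.Properties using () renaming (_≟_ to _≟C_)
open import Data.Rational using (ℚ; 0ℚ; 1ℚ; _+_; _*_; -_)
open import Data.Rational.Properties
open import Data.Rational.Solver using (module +-*-Solver)
open +-*-Solver using (solve; _:+_; _:*_; _:=_; con)
open import Data.List using (List; []; _∷_; _++_; map; concat; concatMap; filter; foldr; length; reverse; upTo; allFin)
import Data.List.Properties as List
import Data.List.NonEmpty as List⁺
open import Data.List.NonEmpty using (List⁺; _∷_; _⁺++_; _⁺++⁺_; _∷⁺_; toList)
open import Data.List.Relation.Unary.All as All using (All; []; _∷_)
import Data.List.Relation.Unary.All.Properties as All
open import Data.List.Relation.Unary.AllPairs as AllPairs using (AllPairs; []; _∷_)
import Data.List.Relation.Unary.AllPairs.Properties as AllPairs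
open import Data.List.Relation.Unary.Any using (Any; here; there; any?)
open import Data.List.Relation.Binary.Disjoint.Propositional using (Disjoint)
open import Data.List.Membership.Propositional using (_∈_; find; lose)
open import Data.List.Membership.Propositional.Properties using (∈-allFin; ∈-upTo⁺; ∈-map⁺; ∈-map⁻; ∈-concatMap⁺; ∈-concatMap⁻; ∈-++⁺ˡ; ∈-++⁺ʳ; ∈-++⁻)
open import Data.List.Relation.Unary.Unique.Propositional using (Unique)
import Data.List.Relation.Unary.Unique.Propositional.Properties as Unique
open import Data.Maybe as Maybe using (just)
import Data.Maybe.Properties as Maybe
open import Data.Sum as Sum using (_⊎_; inj₁; inj₂; [_,_])
open import Data.Empty using (⊥-elim)
open import Data.Product using (_×_; _,_; proj₁; proj₂; map₁; ∃-syntax)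
open import Function using (_∘_; _∋_; id)
open import Relation.Nullary using (Dec; yes; no; ¬_)
open import Relation.Unary using (Decidable)
open import Relation.Binary.Definitions using (DecidableEquality)
open import Relation.Binary.PropositionalEquality using (_≡_; _≢_; refl; sym; trans; cong; cong₂; subst; subst₂; module ≡-Reasoning)
open ≡-Reasoning

-- The words of `Q` are read backwards, so the identity in use is Σ y·ω(S(H_x)) = 0 over w = x·y.
-- Thus S is the antipode for the opposite coproduct, the inverse of the one belonging to Δ itself.
-- This order puts the `y` that lengthens `v` right next to the antipode terms that cancel it.
--
-- `𝔹` is a sum truncated at a bound read off from the list representing f, so that not even its
-- linearity is visible. The transpose `bernstein` is free of that bound, and the truncations are
-- shown to be harmless on the way to `⟪⟫-𝔹`.
--
-- The dualities between enumerations are proved by counting: `∑ xs (λ x → ⟦ x₀ ≟ x ⟧)` is the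
-- multiplicity of `x₀` in `xs`. Most of these counts are found by deleting a first letter, which
-- treats factorizations, coarsenings and sentences of given size alike.
--
-- The induction on J needs the rule for the empty word too, since x in w = x·y may be empty; hence
-- H_w enters as `H (word w)`.

private
  variable
    A B : Set

-- Finite sums

∑ : List A → (A → ℚ) → ℚ
∑ []       f = 0ℚ
∑ (x ∷ xs) f = f x + ∑ xs f

∑-cong : (xs : List A) {f g : A → ℚ} → (∀ x → f x ≡ g x) → ∑ xs f ≡ ∑ xs g
∑-cong []       e = refl
∑-cong (x ∷ xs) e = cong₂ _+_ (e x) (∑-cong xs e)

∑-congᴬ : {P : A → Set} {xs : List A} {f g : A → ℚ} →
  All P xs → (∀ x → P x → f x ≡ g x) → ∑ xs f ≡ ∑ xs g
∑-congᴬ []       e = refl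
∑-congᴬ (p ∷ ps) e = cong₂ _+_ (e _ p) (∑-congᴬ ps e)

∑-++ : (xs ys : List A) (f : A → ℚ) → ∑ (xs ++ ys) f ≡ ∑ xs f + ∑ ys f
∑-++ []       ys f = sym (+-identityˡ _)
∑-++ (x ∷ xs) ys f = trans (cong (f x +_) (∑-++ xs ys f)) (sym (+-assoc (f x) _ _))

∑-map : (g : B → A) (xs : List B) (f : A → ℚ) → ∑ (map g xs) f ≡ ∑ xs (f ∘ g)
∑-map g []       f = refl
∑-map g (x ∷ xs) f = cong (f (g x) +_) (∑-map g xs f)

∑-concatMap : (g : B → List A) (xs : List B) (f : A → ℚ) →
  ∑ (concatMap g xs) f ≡ ∑ xs (λ x → ∑ (g x) f)
∑-concatMap g []       f = refl
∑-concatMap g (x ∷ xs) f = trans (∑-++ (g x) _ f) (cong (∑ (g x) f +_) (∑-concatMap g xs f))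

∑-*ˡ : (a : ℚ) (xs : List A) (f : A → ℚ) → a * ∑ xs f ≡ ∑ xs (λ x → a * f x)
∑-*ˡ a []       f = *-zeroʳ a
∑-*ˡ a (x ∷ xs) f = trans (*-distribˡ-+ a (f x) _) (cong (a * f x +_) (∑-*ˡ a xs f))

∑-*ʳ : (a : ℚ) (xs : List A) (f : A → ℚ) → ∑ xs f * a ≡ ∑ xs (λ x → f x * a)
∑-*ʳ a []       f = *-zeroˡ a
∑-*ʳ a (x ∷ xs) f = trans (*-distribʳ-+ a (f x) _) (cong (f x * a +_) (∑-*ʳ a xs f))

∑-zero : (xs : List A) {f : A → ℚ} → (∀ x → f x ≡ 0ℚ) → ∑ xs f ≡ 0ℚ
∑-zero []       e = refl
∑-zero (x ∷ xs) e = cong₂ _+_ (e x) (∑-zero xs e)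

∑-+ : (xs : List A) (f g : A → ℚ) → ∑ xs (λ x → f x + g x) ≡ ∑ xs f + ∑ xs g
∑-+ []       f g = refl
∑-+ (x ∷ xs) f g = trans (cong (f x + g x +_) (∑-+ xs f g))
  (solve 4 (λ a b c d → (a :+ b) :+ (c :+ d) := (a :+ c) :+ (b :+ d)) refl (f x) (g x) _ _)

∑-swap : (xs : List A) (ys : List B) (f : A → B → ℚ) →
  ∑ xs (λ x → ∑ ys (f x)) ≡ ∑ ys (λ y → ∑ xs (λ x → f x y))
∑-swap []       ys f = sym (∑-zero ys (λ _ → refl))
∑-swap (x ∷ xs) ys f = trans (cong (∑ ys (f x) +_) (∑-swap xs ys f)) (sym (∑-+ ys (f x) _))

-- Indicators

⟦_⟧ : {P : Set} → Dec P → ℚ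
⟦ yes _ ⟧ = 1ℚ
⟦ no _ ⟧  = 0ℚ

⟦⟧-no : {P : Set} (d : Dec P) → ¬ P → ⟦ d ⟧ ≡ 0ℚ
⟦⟧-no (yes p) ¬p = ⊥-elim (¬p p)
⟦⟧-no (no _)  ¬p = refl

⟦⟧-yes : {P : Set} (d : Dec P) → P → ⟦ d ⟧ ≡ 1ℚ
⟦⟧-yes (yes _) p = refl
⟦⟧-yes (no ¬p) p = ⊥-elim (¬p p)

⟦⟧-⇔ : {P Q : Set} (d : Dec P) (e : Dec Q) → (P → Q) → (Q → P) → ⟦ d ⟧ ≡ ⟦ e ⟧
⟦⟧-⇔ (yes p) e f g = sym (⟦⟧-yes e (f p))
⟦⟧-⇔ (no ¬p) e f g = sym (⟦⟧-no e (¬p ∘ g))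

⟦⟧-× : {P Q R : Set} (f : Dec R) (d : Dec P) (e : Dec Q) →
  (R → P × Q) → (P → Q → R) → ⟦ f ⟧ ≡ ⟦ d ⟧ * ⟦ e ⟧
⟦⟧-× f (yes p) e t s = trans (⟦⟧-⇔ f e (proj₂ ∘ t) (s p)) (sym (*-identityˡ _))
⟦⟧-× f (no ¬p) e t s = trans (⟦⟧-no f (¬p ∘ proj₁ ∘ t)) (sym (*-zeroˡ ⟦ e ⟧))

∑-filter : {P : A → Set} (P? : Decidable P) (xs : List A) (f : A → ℚ) →
  ∑ (filter P? xs) f ≡ ∑ xs (λ x → ⟦ P? x ⟧ * f x)
∑-filter P? []       f = refl
∑-filter P? (x ∷ xs) f with P? x
... | yes _ = cong₂ _+_ (sym (*-identityˡ (f x))) (∑-filter P? xs f)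
... | no _  = trans (∑-filter P? xs f) (sym (trans (cong (_+ _) (*-zeroˡ (f x))) (+-identityˡ _)))

module _ (_≟_ : DecidableEquality A) where

  -- The surviving terms all have `x = x₀`, so `g` can be frozen there; what remains is the
  -- multiplicity of `x₀` in `xs`.
  ∑-select : (x₀ : A) (xs : List A) (g : A → ℚ) →
    ∑ xs (λ x → ⟦ x₀ ≟ x ⟧ * g x) ≡ ∑ xs (λ x → ⟦ x₀ ≟ x ⟧) * g x₀
  ∑-select x₀ xs g = trans (∑-cong xs term) (sym (∑-*ʳ (g x₀) xs _))
    where
    term : ∀ x → ⟦ x₀ ≟ x ⟧ * g x ≡ ⟦ x₀ ≟ x ⟧ * g x₀
    term x with x₀ ≟ x
    ... | yes refl = refl
    ... | no _     = trans (*-zeroˡ (g x)) (sym (*-zeroˡ (g x₀)))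

  ∑-select-once : {x₀ : A} (xs : List A) (g : A → ℚ) → ∑ xs (λ x → ⟦ x₀ ≟ x ⟧) ≡ 1ℚ →
    ∑ xs (λ x → ⟦ x₀ ≟ x ⟧ * g x) ≡ g x₀
  ∑-select-once {x₀} xs g e = trans (∑-select x₀ xs g) (trans (cong (_* g x₀) e) (*-identityˡ _))

  ∑-∉ : {x₀ : A} {xs : List A} → ¬ x₀ ∈ xs → ∑ xs (λ x → ⟦ x₀ ≟ x ⟧) ≡ 0ℚ
  ∑-∉ {xs = []}     ∉ = refl
  ∑-∉ {x₀} {x ∷ xs} ∉ = cong₂ _+_ (⟦⟧-no (x₀ ≟ x) (∉ ∘ here)) (∑-∉ (∉ ∘ there))

  -- `Q` is any decidable description of membership, for instance the Pieri condition in
  -- `∑-pieriIndex`.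
  ∑-Unique : {Q : Set} {x₀ : A} {xs : List A} → Unique xs →
    (d : Dec Q) → (Q → x₀ ∈ xs) → (x₀ ∈ xs → Q) → ∑ xs (λ x → ⟦ x₀ ≟ x ⟧) ≡ ⟦ d ⟧
  ∑-Unique u (no ¬q) t s = ∑-∉ (¬q ∘ s)
  ∑-Unique {x₀ = x₀} u (yes q) t s = once u (t q)
    where
    once : ∀ {xs} → Unique xs → x₀ ∈ xs → ∑ xs (λ x → ⟦ x₀ ≟ x ⟧) ≡ 1ℚ
    once (x∉ ∷ u) (here refl) =
      cong₂ _+_ (⟦⟧-yes (x₀ ≟ x₀) refl) (∑-∉ (λ x∈ → All.lookup x∉ x∈ refl))
    once {x ∷ _} (x∉ ∷ u) (there p)   = cong₂ _+_ (⟦⟧-no (x₀ ≟ x) (λ { refl → All.lookup x∉ p refl })) (once u p)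

-- Words and sentences

module _ {n : ℕ} where

  infix 4 _≟W_

  _≟W_ : DecidableEquality (Word {n})
  _≟W_ = List.≡-dec _≟C_

  -- Encodes the convention H_∅ = 1: an empty word contributes no entry, so both extreme splittings
  -- of a word are treated like the others.
  word : Word {n} → Sentence {n}
  word []       = []
  word (c ∷ cs) = (c ∷ cs) ∷ []

  flat : Sentence {n} → Word {n}
  flat []      = []
  flat (w ∷ I) = toList w ++ flat I

  -- The word `u` = q_i⋯q_1 to which `Q` belongs in the Bernstein operator.
  revcat : Sentence {n} → Word {n}
  revcat []      = []
  revcat (w ∷ I) = revcat I ++ toList w

  size-++ : (I J : Sentence {n}) → size (I ++ J) ≡ size I ℕ.+ size J
  size-++ []      J = refl
  size-++ (w ∷ I) J = trans (cong (List⁺.length w ℕ.+_) (size-++ I J)) (sym (ℕₚ.+-assoc (List⁺.length w) (size I) (size J)))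

  size-word : (w : Word {n}) → size (word w) ≡ length w
  size-word []       = refl
  size-word (c ∷ cs) = ℕₚ.+-identityʳ _

  size-word-++ : (w : Word {n}) (I : Sentence {n}) → size (word w ++ I) ≡ length w ℕ.+ size I
  size-word-++ w I = trans (size-++ (word w) I) (cong (ℕ._+ size I) (size-word w))

  flat-++ : (I J : Sentence {n}) → flat (I ++ J) ≡ flat I ++ flat J
  flat-++ []      J = refl
  flat-++ (w ∷ I) J = trans (cong (toList w ++_) (flat-++ I J)) (sym (List.++-assoc (toList w) (flat I) (flat J)))

  flat-word-++ : (w : Word {n}) (I : Sentence {n}) → flat (word w ++ I) ≡ w ++ flat I
  flat-word-++ []       I = refl
  flat-word-++ (c ∷ cs) I = refl

  flat-reverse : (I : Sentence {n}) → flat (reverse I) ≡ revcat I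
  flat-reverse []      = refl
  flat-reverse (w ∷ I) = begin
    flat (reverse (w ∷ I))               ≡⟨ cong flat (List.unfold-reverse w I) ⟩
    flat (reverse I ++ w ∷ [])           ≡⟨ flat-++ (reverse I) (w ∷ []) ⟩
    flat (reverse I) ++ (toList w ++ []) ≡⟨ cong₂ _++_ (flat-reverse I) (List.++-identityʳ (toList w)) ⟩
    revcat I ++ toList w                 ∎

  revcat-++ : (I J : Sentence {n}) → revcat (I ++ J) ≡ revcat J ++ revcat I
  revcat-++ []      J = sym (List.++-identityʳ (revcat J))
  revcat-++ (w ∷ I) J = trans (cong (_++ toList w) (revcat-++ I J)) (List.++-assoc (revcat J) (revcat I) (toList w))

  length-revcat : (I : Sentence {n}) → length (revcat I) ≡ size I
  length-revcat []      = refl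
  length-revcat (w ∷ I) = trans (List.length-++ (revcat I))
    (trans (cong (ℕ._+ _) (length-revcat I)) (ℕₚ.+-comm (size I) _))

  sign-+ : ∀ k l → sign {n} (k ℕ.+ l) ≡ sign {n} k * sign {n} l
  sign-+ zero    l = sym (*-identityˡ _)
  sign-+ (suc k) l = trans (cong -_ (sign-+ k l)) (neg-distribˡ-* (sign {n} k) (sign {n} l))

  sgn : Sentence {n} → ℚ
  sgn Q = sign {n} (ℓ Q)

  sgn-++ : ∀ Q R → sgn (Q ++ R) ≡ sgn Q * sgn R
  sgn-++ Q R = trans (cong (sign {n}) (List.length-++ Q)) (sign-+ (ℓ Q) (ℓ R))

  -- Deconcatenation of words

  splits : Word {n} → List (Word {n} × Word {n})
  splits []       = ([] , []) ∷ []
  splits (c ∷ cs) = ([] , c ∷ cs) ∷ map (map₁ (c ∷_)) (splits cs)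

  splits-++ : ∀ w → All (λ (x , y) → x ++ y ≡ w) (splits w)
  splits-++ []       = refl ∷ []
  splits-++ (c ∷ cs) = refl ∷ All.map⁺ (All.map (cong (c ∷_)) (splits-++ cs))

  ∑-splits-∷ : ∀ c cs (G : Word {n} → Word {n} → ℚ) →
    ∑ (splits (c ∷ cs)) (λ (x , y) → G x y) ≡ G [] (c ∷ cs) + ∑ (splits cs) (λ (x , y) → G (c ∷ x) y)
  ∑-splits-∷ c cs G = cong (G [] (c ∷ cs) +_) (∑-map (map₁ (c ∷_)) (splits cs) _)

  -- Coassociativity of deconcatenation. The induction separates the triples with `x₁` empty from
  -- those in which `x₁` takes the first letter.
  ∑-splits-assoc : ∀ w (F : Word {n} → Word {n} → Word {n} → ℚ) →
    ∑ (splits w) (λ (x , z) → ∑ (splits x) (λ (x₁ , x₂) → F x₁ x₂ z)) ≡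
    ∑ (splits w) (λ (x₁ , t) → ∑ (splits t) (λ (x₂ , z) → F x₁ x₂ z))
  ∑-splits-assoc []       F = refl
  ∑-splits-assoc (c ∷ cs) F = begin
    ∑ (splits (c ∷ cs)) (λ (x , z) → ∑ (splits x) (λ (x₁ , x₂) → F x₁ x₂ z))
      ≡⟨ ∑-splits-∷ c cs (λ x z → ∑ (splits x) (λ (x₁ , x₂) → F x₁ x₂ z)) ⟩
    (F [] [] (c ∷ cs) + 0ℚ) + ∑ (splits cs) (λ (x , z) → ∑ (splits (c ∷ x)) (λ (x₁ , x₂) → F x₁ x₂ z))
      ≡⟨ cong₂ _+_ (+-identityʳ (F [] [] (c ∷ cs))) (∑-cong (splits cs) (λ (x , z) → ∑-splits-∷ c x (λ x₁ x₂ → F x₁ x₂ z))) ⟩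
    F [] [] (c ∷ cs) + ∑ (splits cs) (λ (x , z) → F [] (c ∷ x) z + ∑ (splits x) (λ (x₁ , x₂) → F (c ∷ x₁) x₂ z))
      ≡⟨ cong (F [] [] (c ∷ cs) +_) (∑-+ (splits cs) _ _) ⟩
    F [] [] (c ∷ cs) + (∑ (splits cs) (λ (x , z) → F [] (c ∷ x) z) +
      ∑ (splits cs) (λ (x , z) → ∑ (splits x) (λ (x₁ , x₂) → F (c ∷ x₁) x₂ z)))
      ≡⟨ sym (+-assoc (F [] [] (c ∷ cs)) _ _) ⟩
    (F [] [] (c ∷ cs) + ∑ (splits cs) (λ (x , z) → F [] (c ∷ x) z)) +
      ∑ (splits cs) (λ (x , z) → ∑ (splits x) (λ (x₁ , x₂) → F (c ∷ x₁) x₂ z))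
      ≡⟨ cong₂ _+_ (sym (∑-splits-∷ c cs (F []))) (∑-splits-assoc cs (F ∘ (c ∷_))) ⟩
    ∑ (splits (c ∷ cs)) (λ (x₂ , z) → F [] x₂ z) +
      ∑ (splits cs) (λ (x₁ , t) → ∑ (splits t) (λ (x₂ , z) → F (c ∷ x₁) x₂ z))
      ≡⟨ sym (∑-splits-∷ c cs (λ x₁ t → ∑ (splits t) (λ (x₂ , z) → F x₁ x₂ z))) ⟩
    ∑ (splits (c ∷ cs)) (λ (x₁ , t) → ∑ (splits t) (λ (x₂ , z) → F x₁ x₂ z)) ∎

  -- Multiplication by the counit of H_w; `∑-splits-onEmpty` is then the counit axiom.
  onEmpty : Word {n} → ℚ → ℚ
  onEmpty []      a = a
  onEmpty (_ ∷ _) a = 0ℚ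

  ∑-splits-onEmpty : ∀ w (G : Word {n} → ℚ) → ∑ (splits w) (λ (x , y) → onEmpty y (G x)) ≡ G w
  ∑-splits-onEmpty []       G = +-identityʳ (G [])
  ∑-splits-onEmpty (c ∷ cs) G = trans (∑-splits-∷ c cs (λ x y → onEmpty y (G x)))
    (trans (+-identityˡ _) (∑-splits-onEmpty cs (G ∘ (c ∷_))))

  -- Factorizations of a word into nonempty words

  -- The common local step of `factorizations` and `sentencesOfSize`: the letter starts a word of
  -- its own or joins the first one.
  attach : Fin n → Sentence {n} → List (Sentence {n})
  attach c []      = ((c ∷ []) ∷ []) ∷ []
  attach c (p ∷ P) = ((c ∷ []) ∷ p ∷ P) ∷ ((c ∷⁺ p) ∷ P) ∷ []

  ∑-factorizations-∷ : ∀ c cs (G : Sentence {n} → ℚ) →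
    ∑ (factorizations (c ∷ cs)) G ≡ ∑ (factorizations cs) (λ Q → ∑ (attach c Q) G)
  ∑-factorizations-∷ c cs G = trans (∑-concatMap _ (factorizations cs) G)
    (∑-cong (factorizations cs) (λ { [] → refl ; (p ∷ P) → refl }))

  nonemptySuffixes : Word {n} → List (Word {n} × NWord {n})
  nonemptySuffixes []       = []
  nonemptySuffixes (c ∷ cs) = ([] , c ∷ cs) ∷ map (map₁ (c ∷_)) (nonemptySuffixes cs)

  ∑-nonemptySuffixes-∷ : ∀ c cs (G : Word {n} → NWord {n} → ℚ) →
    ∑ (nonemptySuffixes (c ∷ cs)) (λ (x , y) → G x y) ≡
    G [] (c ∷ cs) + ∑ (nonemptySuffixes cs) (λ (x , y) → G (c ∷ x) y)
  ∑-nonemptySuffixes-∷ c cs G = cong (G [] (c ∷ cs) +_) (∑-map (map₁ (c ∷_)) (nonemptySuffixes cs) _)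

  ∑-splits-nonemptySuffixes : ∀ w (G : Word {n} → Word {n} → ℚ) →
    ∑ (splits w) (λ (x , y) → G x y) ≡ ∑ (nonemptySuffixes w) (λ (x , y) → G x (toList y)) + G w []
  ∑-splits-nonemptySuffixes []       G = +-comm (G [] []) 0ℚ
  ∑-splits-nonemptySuffixes (c ∷ cs) G = begin
    ∑ (splits (c ∷ cs)) (λ (x , y) → G x y)
      ≡⟨ ∑-splits-∷ c cs G ⟩
    G [] (c ∷ cs) + ∑ (splits cs) (λ (x , y) → G (c ∷ x) y)
      ≡⟨ cong (G [] (c ∷ cs) +_) (∑-splits-nonemptySuffixes cs (G ∘ (c ∷_))) ⟩
    G [] (c ∷ cs) + (∑ (nonemptySuffixes cs) (λ (x , y) → G (c ∷ x) (toList y)) + G (c ∷ cs) [])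
      ≡⟨ sym (+-assoc (G [] (c ∷ cs)) _ _) ⟩
    G [] (c ∷ cs) + ∑ (nonemptySuffixes cs) (λ (x , y) → G (c ∷ x) (toList y)) + G (c ∷ cs) []
      ≡⟨ cong (_+ G (c ∷ cs) []) (sym (∑-nonemptySuffixes-∷ c cs (λ x y → G x (toList y)))) ⟩
    ∑ (nonemptySuffixes (c ∷ cs)) (λ (x , y) → G x (toList y)) + G (c ∷ cs) [] ∎

  -- `factorizations` grows at the front, whereas the antipode identity needs the last factor split
  -- off; the two ends interact only when there is a single factor.
  ∑-factorizations-last : ∀ c cs (G : Sentence {n} → ℚ) →
    ∑ (factorizations (c ∷ cs)) G ≡
    ∑ (nonemptySuffixes (c ∷ cs)) (λ (x , y) → ∑ (factorizations x) (λ Q → G (Q ++ y ∷ [])))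
  ∑-factorizations-last c [] G = cong (_+ 0ℚ) (sym (+-identityʳ (G ((c ∷ []) ∷ []))))
  ∑-factorizations-last c (d ∷ ds) G = begin
    ∑ (factorizations (c ∷ d ∷ ds)) G
      ≡⟨ ∑-factorizations-∷ c (d ∷ ds) G ⟩
    ∑ (factorizations (d ∷ ds)) (λ Q → ∑ (attach c Q) G)
      ≡⟨ ∑-factorizations-last d ds (λ Q → ∑ (attach c Q) G) ⟩
    ∑ (nonemptySuffixes (d ∷ ds)) (λ (x , y) → ∑ (factorizations x) (λ Q → ∑ (attach c (Q ++ y ∷ [])) G))
      ≡⟨ ∑-nonemptySuffixes-∷ d ds (λ x y → ∑ (factorizations x) (λ Q → ∑ (attach c (Q ++ y ∷ [])) G)) ⟩
    G ((c ∷ []) ∷ (d ∷ ds) ∷ []) + (G ((c ∷ d ∷ ds) ∷ []) + 0ℚ) + 0ℚ +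
      ∑ (nonemptySuffixes ds) (λ (x , y) → ∑ (factorizations (d ∷ x)) (λ Q → ∑ (attach c (Q ++ y ∷ [])) G))
      -- For empty `x`, attaching `c` to the single factor `d ∷ ds` yields the terms whose last
      -- factors are `d ∷ ds` and `c ∷ d ∷ ds`; the goal lists them in the opposite order.
      ≡⟨ cong₂ _+_ (solve 2 (λ a b → a :+ (b :+ con 0ℚ) :+ con 0ℚ := b :+ con 0ℚ :+ (a :+ con 0ℚ :+ con 0ℚ)) refl
           (G ((c ∷ []) ∷ (d ∷ ds) ∷ [])) (G ((c ∷ d ∷ ds) ∷ [])))
           (∑-cong (nonemptySuffixes ds) (λ (x , y) → attach-∷ʳ x y)) ⟩
    G ((c ∷ d ∷ ds) ∷ []) + 0ℚ + (G ((c ∷ []) ∷ (d ∷ ds) ∷ []) + 0ℚ + 0ℚ) +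
      ∑ (nonemptySuffixes ds) (λ (x , y) → ∑ (factorizations (c ∷ d ∷ x)) (λ Q → G (Q ++ y ∷ [])))
      ≡⟨ +-assoc (G ((c ∷ d ∷ ds) ∷ []) + 0ℚ) _ _ ⟩
    G ((c ∷ d ∷ ds) ∷ []) + 0ℚ + (G ((c ∷ []) ∷ (d ∷ ds) ∷ []) + 0ℚ + 0ℚ +
      ∑ (nonemptySuffixes ds) (λ (x , y) → ∑ (factorizations (c ∷ d ∷ x)) (λ Q → G (Q ++ y ∷ []))))
      ≡⟨ cong (G ((c ∷ d ∷ ds) ∷ []) + 0ℚ +_) (trans
           (cong (λ a → a + ∑ (nonemptySuffixes ds) (λ (x , y) → ∑ (factorizations (c ∷ d ∷ x)) (λ Q → G (Q ++ y ∷ [])))) (+-identityʳ (G ((c ∷ []) ∷ (d ∷ ds) ∷ []) + 0ℚ)))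
           (sym (∑-nonemptySuffixes-∷ d ds (λ x y → ∑ (factorizations (c ∷ x)) (λ Q → G (Q ++ y ∷ [])))))) ⟩
    G ((c ∷ d ∷ ds) ∷ []) + 0ℚ +
      ∑ (nonemptySuffixes (d ∷ ds)) (λ (x , y) → ∑ (factorizations (c ∷ x)) (λ Q → G (Q ++ y ∷ [])))
      ≡⟨ sym (∑-nonemptySuffixes-∷ c (d ∷ ds) (λ x y → ∑ (factorizations x) (λ Q → G (Q ++ y ∷ [])))) ⟩
    ∑ (nonemptySuffixes (c ∷ d ∷ ds)) (λ (x , y) → ∑ (factorizations x) (λ Q → G (Q ++ y ∷ []))) ∎
    where
    attach-∷ʳ : ∀ x y → ∑ (factorizations (d ∷ x)) (λ Q → ∑ (attach c (Q ++ y ∷ [])) G) ≡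
                        ∑ (factorizations (c ∷ d ∷ x)) (λ Q → G (Q ++ y ∷ []))
    attach-∷ʳ x y = begin
      ∑ (factorizations (d ∷ x)) (λ Q → ∑ (attach c (Q ++ y ∷ [])) G)
        ≡⟨ ∑-factorizations-∷ d x (λ Q → ∑ (attach c (Q ++ y ∷ [])) G) ⟩
      ∑ (factorizations x) (λ P → ∑ (attach d P) (λ Q → ∑ (attach c (Q ++ y ∷ [])) G))
        -- `attach d P` has only nonempty entries, and on these `attach c` commutes with appending
        -- `y`.
        ≡⟨ ∑-cong (factorizations x) (λ { [] → refl ; (_ ∷ _) → refl }) ⟩
      ∑ (factorizations x) (λ P → ∑ (attach d P) (λ Q → ∑ (attach c Q) (λ R → G (R ++ y ∷ []))))
        ≡⟨ sym (∑-factorizations-∷ d x (λ Q → ∑ (attach c Q) (λ R → G (R ++ y ∷ [])))) ⟩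
      ∑ (factorizations (d ∷ x)) (λ Q → ∑ (attach c Q) (λ R → G (R ++ y ∷ [])))
        ≡⟨ sym (∑-factorizations-∷ c (d ∷ x) (λ R → G (R ++ y ∷ []))) ⟩
      ∑ (factorizations (c ∷ d ∷ x)) (λ Q → G (Q ++ y ∷ [])) ∎

  -- The antipode identity Σ_{w = x·y} y·S(x) = 0 for w ≠ ∅: splitting the last factor off a
  -- factorization of w flips the sign and keeps the reversed concatenation.
  ∑-splits-antipode : ∀ w (p : Word {n} → ℚ) →
    ∑ (splits w) (λ (x , y) → ∑ (factorizations x) (λ Q → sgn Q * p (y ++ revcat Q))) ≡ onEmpty w (p [])
  ∑-splits-antipode []       p = trans (+-identityʳ _) (trans (+-identityʳ _) (*-identityˡ (p [])))
  ∑-splits-antipode (c ∷ cs) p = begin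
    ∑ (splits (c ∷ cs)) (λ (x , y) → ∑ (factorizations x) (λ Q → sgn Q * p (y ++ revcat Q)))
      -- The splitting with empty second part is the whole signed sum `t`; by `flip` the others add
      -- up to `- t`.
      ≡⟨ ∑-splits-nonemptySuffixes (c ∷ cs) (λ x y → ∑ (factorizations x) (λ Q → sgn Q * p (y ++ revcat Q))) ⟩
    ∑ (nonemptySuffixes (c ∷ cs)) (λ (x , y) → ∑ (factorizations x) (λ Q → sgn Q * p (toList y ++ revcat Q))) + t
      ≡⟨ cong (_+ t) (∑-cong (nonemptySuffixes (c ∷ cs)) (λ (x , y) → ∑-cong (factorizations x) (flip y))) ⟩
    ∑ (nonemptySuffixes (c ∷ cs)) (λ (x , y) → ∑ (factorizations x) (λ Q → - 1ℚ * G (Q ++ y ∷ []))) + t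
      ≡⟨ cong (_+ t) (trans
           (∑-cong (nonemptySuffixes (c ∷ cs)) (λ (x , y) → sym (∑-*ˡ (- 1ℚ) (factorizations x) (λ Q → G (Q ++ y ∷ [])))))
           (sym (∑-*ˡ (- 1ℚ) (nonemptySuffixes (c ∷ cs)) (λ (x , y) → ∑ (factorizations x) (λ Q → G (Q ++ y ∷ [])))))) ⟩
    - 1ℚ * ∑ (nonemptySuffixes (c ∷ cs)) (λ (x , y) → ∑ (factorizations x) (λ Q → G (Q ++ y ∷ []))) + t
      ≡⟨ cong (λ s → - 1ℚ * s + t) (sym (∑-factorizations-last c cs G)) ⟩
    - 1ℚ * t + t
      ≡⟨ solve 1 (λ a → con (- 1ℚ) :* a :+ a := con 0ℚ) refl t ⟩
    0ℚ ∎
    where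
    G : Sentence {n} → ℚ
    G Q = sgn Q * p (revcat Q)
    t : ℚ
    t = ∑ (factorizations (c ∷ cs)) G
    flip : ∀ y Q → sgn Q * p (toList y ++ revcat Q) ≡ - 1ℚ * G (Q ++ y ∷ [])
    flip y Q = begin
      sgn Q * p (toList y ++ revcat Q)
        ≡⟨ solve 2 (λ a b → a :* b := con (- 1ℚ) :* (a :* con (- 1ℚ) :* b)) refl (sgn Q) (p (toList y ++ revcat Q)) ⟩
      - 1ℚ * (sgn Q * - 1ℚ * p (toList y ++ revcat Q))
        ≡⟨ cong (- 1ℚ *_) (cong₂ _*_ (sym (sgn-++ Q (y ∷ []))) (cong p (sym (revcat-++ Q (y ∷ []))))) ⟩
      - 1ℚ * G (Q ++ y ∷ []) ∎

  -- Refinements and the coproduct of H_I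

  -- These are the `R` ⪯ `I`; with sign `sgn R` and read backwards they give the terms of S(H_I).
  refine : Sentence {n} → List (Sentence {n})
  refine []      = [] ∷ []
  refine (w ∷ I) = concatMap (λ Q → map (Q ++_) (refine I)) (factorizations (toList w))

  ∑-refine-∷ : ∀ w I (G : Sentence {n} → ℚ) →
    ∑ (refine (w ∷ I)) G ≡ ∑ (factorizations (toList w)) (λ Q → ∑ (refine I) (λ R → G (Q ++ R)))
  ∑-refine-∷ w I G = trans (∑-concatMap _ (factorizations (toList w)) G)
    (∑-cong (factorizations (toList w)) (λ Q → ∑-map (Q ++_) (refine I) G))

  ∑-refine-++-word : ∀ I w (G : Sentence {n} → ℚ) →
    ∑ (refine (I ++ word w)) G ≡ ∑ (refine I) (λ R → ∑ (factorizations w) (λ Q → G (R ++ Q)))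
  ∑-refine-++-word [] []       G = sym (+-identityʳ _)
  ∑-refine-++-word [] (c ∷ cs) G = begin
    ∑ (refine ((c ∷ cs) ∷ [])) G
      ≡⟨ ∑-refine-∷ (c ∷ cs) [] G ⟩
    ∑ (factorizations (c ∷ cs)) (λ Q → G (Q ++ []) + 0ℚ)
      ≡⟨ ∑-cong (factorizations (c ∷ cs)) (λ Q → trans (+-identityʳ _) (cong G (List.++-identityʳ Q))) ⟩
    ∑ (factorizations (c ∷ cs)) G
      ≡⟨ sym (+-identityʳ _) ⟩
    ∑ (factorizations (c ∷ cs)) G + 0ℚ ∎
  ∑-refine-++-word (v ∷ I) w G = begin
    ∑ (refine (v ∷ I ++ word w)) G
      ≡⟨ ∑-refine-∷ v (I ++ word w) G ⟩
    ∑ (factorizations (toList v)) (λ P → ∑ (refine (I ++ word w)) (λ R → G (P ++ R)))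
      ≡⟨ ∑-cong (factorizations (toList v)) (λ P → trans (∑-refine-++-word I w (G ∘ (P ++_)))
           (∑-cong (refine I) (λ R → ∑-cong (factorizations w) (λ Q → cong G (sym (List.++-assoc P R Q)))))) ⟩
    ∑ (factorizations (toList v)) (λ P → ∑ (refine I) (λ R → ∑ (factorizations w) (λ Q → G ((P ++ R) ++ Q))))
      ≡⟨ sym (∑-refine-∷ v I (λ R → ∑ (factorizations w) (λ Q → G (R ++ Q)))) ⟩
    ∑ (refine (v ∷ I)) (λ R → ∑ (factorizations w) (λ Q → G (R ++ Q))) ∎

  prepend : Word {n} × Word {n} → Sentence {n} × Sentence {n} → Sentence {n} × Sentence {n}
  prepend (x , y) (I₁ , I₂) = word x ++ I₁ , word y ++ I₂

  -- The terms of the coproduct of H_I, from Δ(H_w) = Σ_{w = x·y} H_x ⊗ H_y.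
  cut : Sentence {n} → List (Sentence {n} × Sentence {n})
  cut []      = ([] , []) ∷ []
  cut (w ∷ I) = concatMap (λ s → map (prepend s) (cut I)) (splits (toList w))

  ∑-cut-∷ : ∀ w I (G : Sentence {n} → Sentence {n} → ℚ) →
    ∑ (cut (w ∷ I)) (λ (I₁ , I₂) → G I₁ I₂) ≡
    ∑ (splits (toList w)) (λ (x , y) → ∑ (cut I) (λ (I₁ , I₂) → G (word x ++ I₁) (word y ++ I₂)))
  ∑-cut-∷ w I G = trans (∑-concatMap (λ s → map (prepend s) (cut I)) (splits (toList w)) _)
    (∑-cong (splits (toList w)) (λ s → ∑-map (prepend s) (cut I) (λ (I₁ , I₂) → G I₁ I₂)))

  ∑-cut-++-word : ∀ I w (G : Sentence {n} → Sentence {n} → ℚ) →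
    ∑ (cut (I ++ word w)) (λ (I₁ , I₂) → G I₁ I₂) ≡
    ∑ (cut I) (λ (I₁ , I₂) → ∑ (splits w) (λ (x , y) → G (I₁ ++ word x) (I₂ ++ word y)))
  ∑-cut-++-word [] []       G = sym (+-identityʳ _)
  ∑-cut-++-word [] (c ∷ cs) G = begin
    ∑ (cut ((c ∷ cs) ∷ [])) (λ (I₁ , I₂) → G I₁ I₂)
      ≡⟨ ∑-cut-∷ (c ∷ cs) [] G ⟩
    ∑ (splits (c ∷ cs)) (λ (x , y) → G (word x ++ []) (word y ++ []) + 0ℚ)
      ≡⟨ ∑-cong (splits (c ∷ cs)) (λ (x , y) → trans (+-identityʳ _)
           (cong₂ G (List.++-identityʳ (word x)) (List.++-identityʳ (word y)))) ⟩
    ∑ (splits (c ∷ cs)) (λ (x , y) → G (word x) (word y))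
      ≡⟨ sym (+-identityʳ _) ⟩
    ∑ (splits (c ∷ cs)) (λ (x , y) → G (word x) (word y)) + 0ℚ ∎
  ∑-cut-++-word (v ∷ I) w G = begin
    ∑ (cut (v ∷ I ++ word w)) (λ (I₁ , I₂) → G I₁ I₂)
      ≡⟨ ∑-cut-∷ v (I ++ word w) G ⟩
    ∑ (splits (toList v)) (λ (a , b) → ∑ (cut (I ++ word w)) (λ (I₁ , I₂) → G (word a ++ I₁) (word b ++ I₂)))
      ≡⟨ ∑-cong (splits (toList v)) (λ (a , b) → trans
           (∑-cut-++-word I w (λ I₁ I₂ → G (word a ++ I₁) (word b ++ I₂)))
           (∑-cong (cut I) (λ (I₁ , I₂) → ∑-cong (splits w) (λ (x , y) →
             cong₂ G (sym (List.++-assoc (word a) I₁ (word x))) (sym (List.++-assoc (word b) I₂ (word y))))))) ⟩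
    ∑ (splits (toList v)) (λ (a , b) → ∑ (cut I) (λ (I₁ , I₂) → ∑ (splits w) (λ (x , y) →
      G ((word a ++ I₁) ++ word x) ((word b ++ I₂) ++ word y))))
      ≡⟨ sym (∑-cut-∷ v I (λ I₁ I₂ → ∑ (splits w) (λ (x , y) → G (I₁ ++ word x) (I₂ ++ word y)))) ⟩
    ∑ (cut (v ∷ I)) (λ (I₁ , I₂) → ∑ (splits w) (λ (x , y) → G (I₁ ++ word x) (I₂ ++ word y))) ∎

  -- The Bernstein operator

  -- With ω the algebra map H_w ↦ w into the free algebra and S the antipode, this is the value at
  -- Σ H_{(1)} ⊗ ω(S(H_{(2)})), for H = H_I, of the functional sending H_K ⊗ u to k K u.
  twist : Sentence {n} → (Sentence {n} → Word {n} → ℚ) → ℚ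
  twist I k = ∑ (cut I) (λ (I₁ , I₂) → ∑ (refine I₂) (λ R → sgn R * k I₁ (revcat R)))

  twist-cong : ∀ I {k l : Sentence {n} → Word {n} → ℚ} → (∀ K u → k K u ≡ l K u) → twist I k ≡ twist I l
  twist-cong I e = ∑-cong (cut I) (λ (I₁ , I₂) → ∑-cong (refine I₂) (λ R → cong (sgn R *_) (e I₁ (revcat R))))

  -- The new factors `Q` come last in the refinement `R ++ Q`, hence first in `revcat`: this is the
  -- reversal of products by S.
  twist-++-word : ∀ I w (k : Sentence {n} → Word {n} → ℚ) →
    twist (I ++ word w) k ≡
    ∑ (splits w) (λ (x , y) → ∑ (factorizations y) (λ Q →
      sgn Q * twist I (λ K u → k (K ++ word x) (revcat Q ++ u))))
  twist-++-word I w k = begin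
    twist (I ++ word w) k
      ≡⟨ ∑-cut-++-word I w (λ I₁ I₂ → ∑ (refine I₂) (λ R → sgn R * k I₁ (revcat R))) ⟩
    ∑ (cut I) (λ (I₁ , I₂) → ∑ (splits w) (λ (x , y) →
      ∑ (refine (I₂ ++ word y)) (λ R → sgn R * k (I₁ ++ word x) (revcat R))))
      ≡⟨ ∑-cong (cut I) (λ (I₁ , I₂) → ∑-cong (splits w) (λ (x , y) →
           trans (∑-refine-++-word I₂ y (λ R → sgn R * k (I₁ ++ word x) (revcat R)))
                 (∑-swap (refine I₂) (factorizations y) _))) ⟩
    ∑ (cut I) (λ (I₁ , I₂) → ∑ (splits w) (λ (x , y) → ∑ (factorizations y) (λ Q → ∑ (refine I₂) (λ R →
      sgn (R ++ Q) * k (I₁ ++ word x) (revcat (R ++ Q))))))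
      ≡⟨ ∑-swap (cut I) (splits w) _ ⟩
    ∑ (splits w) (λ (x , y) → ∑ (cut I) (λ (I₁ , I₂) → ∑ (factorizations y) (λ Q → ∑ (refine I₂) (λ R →
      sgn (R ++ Q) * k (I₁ ++ word x) (revcat (R ++ Q))))))
      ≡⟨ ∑-cong (splits w) (λ (x , y) → ∑-swap (cut I) (factorizations y) _) ⟩
    ∑ (splits w) (λ (x , y) → ∑ (factorizations y) (λ Q → ∑ (cut I) (λ (I₁ , I₂) → ∑ (refine I₂) (λ R →
      sgn (R ++ Q) * k (I₁ ++ word x) (revcat (R ++ Q))))))
      ≡⟨ ∑-cong (splits w) (λ (x , y) → ∑-cong (factorizations y) (λ Q → factor x Q)) ⟩
    ∑ (splits w) (λ (x , y) → ∑ (factorizations y) (λ Q →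
      sgn Q * twist I (λ K u → k (K ++ word x) (revcat Q ++ u)))) ∎
    where
    factor : ∀ x Q →
      ∑ (cut I) (λ (I₁ , I₂) → ∑ (refine I₂) (λ R → sgn (R ++ Q) * k (I₁ ++ word x) (revcat (R ++ Q)))) ≡
      sgn Q * twist I (λ K u → k (K ++ word x) (revcat Q ++ u))
    factor x Q = sym (trans (∑-*ˡ (sgn Q) (cut I) _) (∑-cong (cut I) (λ (I₁ , I₂) →
      trans (∑-*ˡ (sgn Q) (refine I₂) _) (∑-cong (refine I₂) (λ R → begin
        sgn Q * (sgn R * k (I₁ ++ word x) (revcat Q ++ revcat R))
          ≡⟨ solve 3 (λ a b c → a :* (b :* c) := b :* a :* c) refl (sgn Q) (sgn R) (k (I₁ ++ word x) (revcat Q ++ revcat R)) ⟩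
        sgn R * sgn Q * k (I₁ ++ word x) (revcat Q ++ revcat R)
          ≡⟨ cong₂ _*_ (sym (sgn-++ R Q)) (cong (k (I₁ ++ word x)) (sym (revcat-++ R Q))) ⟩
        sgn (R ++ Q) * k (I₁ ++ word x) (revcat (R ++ Q)) ∎)))))

  -- The transpose of `𝔹 v`, evaluated at H_I; `⟪⟫-𝔹` ties it to the definition of `𝔹`.
  bernstein : NWord {n} → (Sentence {n} → ℚ) → Sentence {n} → ℚ
  bernstein v h I = twist I (λ K u → h ((v ⁺++ u) ∷ K))

  bernstein-++-word : ∀ v (h : Sentence {n} → ℚ) I w →
    bernstein v (λ K → h (K ++ word w)) I ≡
    ∑ (splits w) (λ (x , y) → bernstein (v ⁺++ y) h (I ++ word x))
  bernstein-++-word v h I w = sym (begin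
    ∑ (splits w) (λ (x , y) → bernstein (v ⁺++ y) h (I ++ word x))
      ≡⟨ ∑-cong (splits w) (λ (x , y) → trans (twist-++-word I x (λ K u → h (((v ⁺++ y) ⁺++ u) ∷ K)))
           (∑-cong (splits x) (λ (x₁ , x₂) → ∑-cong (factorizations x₂) (λ Q → cong (sgn Q *_)
             (twist-cong I (λ K u → cong (λ a → h (a ∷ (K ++ word x₁))) (assoc y (revcat Q) u))))))) ⟩
    ∑ (splits w) (λ (x , y) → ∑ (splits x) (λ (x₁ , x₂) → ∑ (factorizations x₂) (λ Q →
      sgn Q * p x₁ (y ++ revcat Q))))
      -- Regroups `x₂` and `y` into one word `t`, on which the antipode identity acts while `x₁`
      -- stays fixed.
      ≡⟨ ∑-splits-assoc w (λ x₁ x₂ y → ∑ (factorizations x₂) (λ Q → sgn Q * p x₁ (y ++ revcat Q))) ⟩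
    ∑ (splits w) (λ (x₁ , t) → ∑ (splits t) (λ (x₂ , y) → ∑ (factorizations x₂) (λ Q →
      sgn Q * p x₁ (y ++ revcat Q))))
      ≡⟨ ∑-cong (splits w) (λ (x₁ , t) → ∑-splits-antipode t (p x₁)) ⟩
    ∑ (splits w) (λ (x₁ , t) → onEmpty t (p x₁ []))
      ≡⟨ ∑-splits-onEmpty w (λ x → p x []) ⟩
    p w [] ∎)
    where
    p : Word {n} → Word {n} → ℚ
    p x z = twist I (λ K u → h ((v ⁺++ (z ++ u)) ∷ (K ++ word x)))
    assoc : ∀ y z u → ((v ⁺++ y) ⁺++ (z ++ u)) ≡ (v ⁺++ ((y ++ z) ++ u))
    assoc y z u = cong (List⁺.head v ∷_) (trans (List.++-assoc (List⁺.tail v) y (z ++ u))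
      (cong (List⁺.tail v ++_) (sym (List.++-assoc y z u))))

  -- Each enumeration lists its elements exactly once

  ∑-attach-[] : ∀ c Q → ∑ (attach c Q) (λ R → ⟦ [] ≟S R ⟧) ≡ 0ℚ
  ∑-attach-[] c []      = refl
  ∑-attach-[] c (_ ∷ _) = refl

  -- `attach` is undone by deleting the first letter, which leaves `word ds ++ P` for either
  -- alternative: `word` drops the first entry exactly when it has become empty.
  ∑-attach : ∀ c Q d ds P →
    ∑ (attach c Q) (λ R → ⟦ ((d ∷ ds) ∷ P) ≟S R ⟧) ≡ ⟦ d ≟C c ⟧ * ⟦ (word ds ++ P) ≟S Q ⟧
  ∑-attach c [] d [] P = trans (+-identityʳ _) (⟦⟧-× (((d ∷ []) ∷ P) ≟S ((c ∷ []) ∷ [])) (d ≟C c) (P ≟S [])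
    (λ { refl → refl , refl }) (λ { refl refl → refl }))
  ∑-attach c [] d (e ∷ es) P = trans (cong (_+ 0ℚ) (⟦⟧-no (((d ∷ e ∷ es) ∷ P) ≟S ((c ∷ []) ∷ [])) (λ ())))
    (sym (*-zeroʳ ⟦ d ≟C c ⟧))
  ∑-attach c (q ∷ Q) d [] P = begin
    ⟦ ((d ∷ []) ∷ P) ≟S ((c ∷ []) ∷ q ∷ Q) ⟧ + (⟦ ((d ∷ []) ∷ P) ≟S ((c ∷⁺ q) ∷ Q) ⟧ + 0ℚ)
      ≡⟨ cong₂ _+_ (⟦⟧-× (((d ∷ []) ∷ P) ≟S ((c ∷ []) ∷ q ∷ Q)) (d ≟C c) (P ≟S (q ∷ Q))
           (λ { refl → refl , refl }) (λ { refl refl → refl }))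
           (cong (_+ 0ℚ) (⟦⟧-no (((d ∷ []) ∷ P) ≟S ((c ∷⁺ q) ∷ Q)) (λ ()))) ⟩
    ⟦ d ≟C c ⟧ * ⟦ P ≟S (q ∷ Q) ⟧ + 0ℚ
      ≡⟨ +-identityʳ _ ⟩
    ⟦ d ≟C c ⟧ * ⟦ P ≟S (q ∷ Q) ⟧ ∎
  ∑-attach c (q ∷ Q) d (e ∷ es) P = begin
    ⟦ ((d ∷ e ∷ es) ∷ P) ≟S ((c ∷ []) ∷ q ∷ Q) ⟧ + (⟦ ((d ∷ e ∷ es) ∷ P) ≟S ((c ∷⁺ q) ∷ Q) ⟧ + 0ℚ)
      ≡⟨ cong₂ _+_ (⟦⟧-no (((d ∷ e ∷ es) ∷ P) ≟S ((c ∷ []) ∷ q ∷ Q)) (λ ()))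
           (+-identityʳ ⟦ ((d ∷ e ∷ es) ∷ P) ≟S ((c ∷⁺ q) ∷ Q) ⟧) ⟩
    0ℚ + ⟦ ((d ∷ e ∷ es) ∷ P) ≟S ((c ∷⁺ q) ∷ Q) ⟧
      ≡⟨ +-identityˡ _ ⟩
    ⟦ ((d ∷ e ∷ es) ∷ P) ≟S ((c ∷⁺ q) ∷ Q) ⟧
      ≡⟨ ⟦⟧-× (((d ∷ e ∷ es) ∷ P) ≟S ((c ∷⁺ q) ∷ Q)) (d ≟C c) (((e ∷ es) ∷ P) ≟S (q ∷ Q))
           (λ { refl → refl , refl }) (λ { refl refl → refl }) ⟩
    ⟦ d ≟C c ⟧ * ⟦ ((e ∷ es) ∷ P) ≟S (q ∷ Q) ⟧ ∎

  ∑-allFin : ∀ d → ∑ (allFin n) (λ c → ⟦ d ≟C c ⟧) ≡ 1ℚ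
  ∑-allFin d = ∑-Unique _≟C_ (Unique.allFin⁺ n) (yes (∈-allFin d)) id id

  ∑-factorizations : ∀ Q w → ∑ (factorizations w) (λ R → ⟦ Q ≟S R ⟧) ≡ ⟦ flat Q ≟W w ⟧
  ∑-factorizations []             []       = refl
  ∑-factorizations ((d ∷ ds) ∷ P) []       = refl
  ∑-factorizations []             (c ∷ cs) =
    trans (∑-factorizations-∷ c cs _) (∑-zero (factorizations cs) (∑-attach-[] c))
  ∑-factorizations ((d ∷ ds) ∷ P) (c ∷ cs) = begin
    ∑ (factorizations (c ∷ cs)) (λ R → ⟦ ((d ∷ ds) ∷ P) ≟S R ⟧)
      ≡⟨ ∑-factorizations-∷ c cs _ ⟩
    ∑ (factorizations cs) (λ Q → ∑ (attach c Q) (λ R → ⟦ ((d ∷ ds) ∷ P) ≟S R ⟧))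
      ≡⟨ ∑-cong (factorizations cs) (λ Q → ∑-attach c Q d ds P) ⟩
    ∑ (factorizations cs) (λ Q → ⟦ d ≟C c ⟧ * ⟦ (word ds ++ P) ≟S Q ⟧)
      ≡⟨ sym (∑-*ˡ ⟦ d ≟C c ⟧ (factorizations cs) _) ⟩
    ⟦ d ≟C c ⟧ * ∑ (factorizations cs) (λ Q → ⟦ (word ds ++ P) ≟S Q ⟧)
      ≡⟨ cong (⟦ d ≟C c ⟧ *_) (∑-factorizations (word ds ++ P) cs) ⟩
    ⟦ d ≟C c ⟧ * ⟦ flat (word ds ++ P) ≟W cs ⟧
      ≡⟨ sym (⟦⟧-× ((d ∷ ds ++ flat P) ≟W (c ∷ cs)) (d ≟C c) (flat (word ds ++ P) ≟W cs)
           (λ { refl → refl , flat-word-++ ds P })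
           (λ { refl e → cong (d ∷_) (trans (sym (flat-word-++ ds P)) e) })) ⟩
    ⟦ (d ∷ ds ++ flat P) ≟W (c ∷ cs) ⟧ ∎

  ∑-sentencesOfSize : ∀ K m → ∑ (sentencesOfSize {n} m) (λ L → ⟦ K ≟S L ⟧) ≡ ⟦ size K ℕ.≟ m ⟧
  ∑-sentencesOfSize []             zero    = refl
  ∑-sentencesOfSize ((d ∷ ds) ∷ P) zero    = refl
  ∑-sentencesOfSize K              (suc m) = begin
    ∑ (sentencesOfSize {n} (suc m)) (λ L → ⟦ K ≟S L ⟧)
      ≡⟨ trans (∑-concatMap _ (sentencesOfSize {n} m) _) (∑-cong (sentencesOfSize {n} m) (λ Q →
           trans (∑-concatMap _ (allFin n) _) (∑-cong (allFin n) (λ c → byAttach Q c)))) ⟩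
    ∑ (sentencesOfSize {n} m) (λ Q → ∑ (allFin n) (λ c → ∑ (attach c Q) (λ L → ⟦ K ≟S L ⟧)))
      ≡⟨ count K ⟩
    ⟦ size K ℕ.≟ suc m ⟧ ∎
    where
    -- The left side contains the local function `ext` and is left to unification; it agrees with
    -- `attach` once `Q` is split.
    byAttach : ∀ Q c → _ ≡ ∑ (attach c Q) (λ L → ⟦ K ≟S L ⟧)
    byAttach []      c = refl
    byAttach (_ ∷ _) c = refl
    count : ∀ K → ∑ (sentencesOfSize {n} m) (λ Q → ∑ (allFin n) (λ c → ∑ (attach c Q) (λ L → ⟦ K ≟S L ⟧))) ≡
                  ⟦ size K ℕ.≟ suc m ⟧
    count []             = ∑-zero (sentencesOfSize {n} m) (λ Q → ∑-zero (allFin n) (λ c → ∑-attach-[] c Q))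
    count ((d ∷ ds) ∷ P) = begin
      ∑ (sentencesOfSize {n} m) (λ Q → ∑ (allFin n) (λ c → ∑ (attach c Q) (λ L → ⟦ ((d ∷ ds) ∷ P) ≟S L ⟧)))
        ≡⟨ ∑-cong (sentencesOfSize {n} m) (λ Q → trans (∑-cong (allFin n) (λ c → ∑-attach c Q d ds P))
             (trans (sym (∑-*ʳ ⟦ (word ds ++ P) ≟S Q ⟧ (allFin n) _))
               (trans (cong (_* ⟦ (word ds ++ P) ≟S Q ⟧) (∑-allFin d)) (*-identityˡ _)))) ⟩
      ∑ (sentencesOfSize {n} m) (λ Q → ⟦ (word ds ++ P) ≟S Q ⟧)
        ≡⟨ ∑-sentencesOfSize (word ds ++ P) m ⟩
      ⟦ size (word ds ++ P) ℕ.≟ m ⟧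
        ≡⟨ ⟦⟧-⇔ (size (word ds ++ P) ℕ.≟ m) (size ((d ∷ ds) ∷ P) ℕ.≟ suc m)
             (λ e → cong suc (trans (sym (size-word-++ ds P)) e))
             (λ e → trans (size-word-++ ds P) (ℕₚ.suc-injective e)) ⟩
      ⟦ size ((d ∷ ds) ∷ P) ℕ.≟ suc m ⟧ ∎

  ∑-upTo : ∀ {k N} → k ≤ N → ∑ (upTo (suc N)) (λ m → ⟦ k ℕ.≟ m ⟧) ≡ 1ℚ
  ∑-upTo k≤N = ∑-Unique ℕ._≟_ (Unique.upTo⁺ _) (yes (∈-upTo⁺ (s≤s k≤N))) id id

  ∑-sentencesUpTo : ∀ {K N} → size K ≤ N → ∑ (sentencesUpTo {n} N) (λ L → ⟦ K ≟S L ⟧) ≡ 1ℚ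
  ∑-sentencesUpTo {K} {N} le = trans (∑-concatMap sentencesOfSize (upTo (suc N)) (λ L → ⟦ K ≟S L ⟧))
    (trans (∑-cong (upTo (suc N)) (∑-sentencesOfSize K)) (∑-upTo le))

  ∑-wordsOfLength : ∀ w k → ∑ (wordsOfLength {n} k) (λ u → ⟦ w ≟W u ⟧) ≡ ⟦ length w ℕ.≟ k ⟧
  ∑-wordsOfLength []       zero    = refl
  ∑-wordsOfLength (c ∷ cs) zero    = refl
  ∑-wordsOfLength []       (suc k) = trans (∑-concatMap _ (allFin n) _)
    (∑-zero (allFin n) (λ c → trans (∑-map (c ∷_) (wordsOfLength k) _) (∑-zero (wordsOfLength k) (λ _ → refl))))
  ∑-wordsOfLength (c ∷ cs) (suc k) = begin
    ∑ (wordsOfLength {n} (suc k)) (λ u → ⟦ (c ∷ cs) ≟W u ⟧)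
      ≡⟨ trans (∑-concatMap _ (allFin n) _) (∑-cong (allFin n) (λ d → ∑-map (d ∷_) (wordsOfLength k) _)) ⟩
    ∑ (allFin n) (λ d → ∑ (wordsOfLength k) (λ u → ⟦ (c ∷ cs) ≟W (d ∷ u) ⟧))
      ≡⟨ ∑-cong (allFin n) (λ d → trans (∑-cong (wordsOfLength k) (λ u →
           ⟦⟧-× ((c ∷ cs) ≟W (d ∷ u)) (c ≟C d) (cs ≟W u) (λ { refl → refl , refl }) (λ { refl refl → refl })))
           (sym (∑-*ˡ ⟦ c ≟C d ⟧ (wordsOfLength k) _))) ⟩
    ∑ (allFin n) (λ d → ⟦ c ≟C d ⟧ * ∑ (wordsOfLength k) (λ u → ⟦ cs ≟W u ⟧))
      ≡⟨ ∑-select-once _≟C_ {c} (allFin n) (λ _ → ∑ (wordsOfLength k) (λ u → ⟦ cs ≟W u ⟧)) (∑-allFin c) ⟩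
    ∑ (wordsOfLength k) (λ u → ⟦ cs ≟W u ⟧)
      ≡⟨ ∑-wordsOfLength cs k ⟩
    ⟦ length cs ℕ.≟ k ⟧
      ≡⟨ ⟦⟧-⇔ (length cs ℕ.≟ k) (suc (length cs) ℕ.≟ suc k) (cong suc) ℕₚ.suc-injective ⟩
    ⟦ suc (length cs) ℕ.≟ suc k ⟧ ∎

  ∑-wordsUpTo : ∀ {w N} → length w ≤ N → ∑ (wordsUpTo {n} N) (λ u → ⟦ w ≟W u ⟧) ≡ 1ℚ
  ∑-wordsUpTo {w} {N} le = trans (∑-concatMap wordsOfLength (upTo (suc N)) (λ u → ⟦ w ≟W u ⟧))
    (trans (∑-cong (upTo (suc N)) (∑-wordsOfLength w)) (∑-upTo le))

  -- Coarsening is adjoint to refinement, the quasi-shuffle product to the coproduct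

  -- The local step of `coarsenings`.
  merge : NWord {n} → Sentence {n} → List (Sentence {n})
  merge q []      = (q ∷ []) ∷ []
  merge q (s ∷ S) = (q ∷ s ∷ S) ∷ ((q ⁺++⁺ s) ∷ S) ∷ []

  ∑-coarsenings-∷ : ∀ q Q (G : Sentence {n} → ℚ) →
    ∑ (coarsenings (q ∷ Q)) G ≡ ∑ (coarsenings Q) (λ S → ∑ (merge q S) G)
  ∑-coarsenings-∷ q Q G = trans (∑-concatMap _ (coarsenings Q) G)
    (∑-cong (coarsenings Q) (λ { [] → refl ; (_ ∷ _) → refl }))

  ∑-refine-letter : ∀ c I (G : Sentence {n} → ℚ) →
    ∑ (refine ((c ∷ []) ∷ I)) G ≡ ∑ (refine I) (λ R → G ((c ∷ []) ∷ R))
  ∑-refine-letter c I G = trans (∑-refine-∷ (c ∷ []) I G) (+-identityʳ _)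

  -- In a word of at least two letters `c` is either cut off or joins the first factor of the rest.
  -- For a one-letter word the cut is forced, whence the separate `∑-refine-letter`.
  ∑-refine-attach : ∀ c d ds I (G : Sentence {n} → ℚ) →
    ∑ (refine ((c ∷ d ∷ ds) ∷ I)) G ≡ ∑ (refine ((d ∷ ds) ∷ I)) (λ R → ∑ (attach c R) G)
  ∑-refine-attach c d ds I G = begin
    ∑ (refine ((c ∷ d ∷ ds) ∷ I)) G
      ≡⟨ ∑-refine-∷ (c ∷ d ∷ ds) I G ⟩
    ∑ (factorizations (c ∷ d ∷ ds)) (λ Q → ∑ (refine I) (λ R → G (Q ++ R)))
      ≡⟨ trans (∑-factorizations-∷ c (d ∷ ds) _) (∑-factorizations-∷ d ds _) ⟩
    ∑ (factorizations ds) (λ P → ∑ (attach d P) (λ P → ∑ (attach c P) (λ Q → ∑ (refine I) (λ R → G (Q ++ R)))))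
      -- For empty `Q`, `attach c (Q ++ R)` could lengthen the first word of `R`; the entries of
      -- `attach d P` are never empty.
      ≡⟨ ∑-cong (factorizations ds) (λ P → ∑-congᴬ (nonempty P) (λ { [] ne → ⊥-elim (ne refl) ; (p ∷ P) _ → pull p P })) ⟩
    ∑ (factorizations ds) (λ P → ∑ (attach d P) (λ Q → ∑ (refine I) (λ R → ∑ (attach c (Q ++ R)) G)))
      ≡⟨ sym (∑-factorizations-∷ d ds (λ Q → ∑ (refine I) (λ R → ∑ (attach c (Q ++ R)) G))) ⟩
    ∑ (factorizations (d ∷ ds)) (λ Q → ∑ (refine I) (λ R → ∑ (attach c (Q ++ R)) G))
      ≡⟨ sym (∑-refine-∷ (d ∷ ds) I (λ R → ∑ (attach c R) G)) ⟩
    ∑ (refine ((d ∷ ds) ∷ I)) (λ R → ∑ (attach c R) G) ∎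
    where
    nonempty : ∀ P → All (_≢ []) (attach d P)
    nonempty []      = (λ ()) ∷ []
    nonempty (_ ∷ _) = (λ ()) ∷ (λ ()) ∷ []
    pull : ∀ p P → ∑ (attach c (p ∷ P)) (λ Q → ∑ (refine I) (λ R → G (Q ++ R))) ≡
                   ∑ (refine I) (λ R → ∑ (attach c ((p ∷ P) ++ R)) G)
    pull p P = ∑-swap (attach c (p ∷ P)) (refine I) (λ Q R → G (Q ++ R))

  ⟦∷⟧ : ∀ (v : NWord {n}) I w J → ⟦ (v ∷ I) ≟S (w ∷ J) ⟧ ≡ ⟦ v ≟W⁺ w ⟧ * ⟦ I ≟S J ⟧
  ⟦∷⟧ v I w J = ⟦⟧-× ((v ∷ I) ≟S (w ∷ J)) (v ≟W⁺ w) (I ≟S J) (λ { refl → refl , refl }) (λ { refl refl → refl })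

  letter≢⁺++⁺ : ∀ {c : Fin n} (v w : NWord {n}) → (c ∷ []) ≢ (v ⁺++⁺ w)
  letter≢⁺++⁺ (_ ∷ [])    w ()
  letter≢⁺++⁺ (_ ∷ _ ∷ _) w ()

  ∑-merge-letter : ∀ q S c I →
    ∑ (merge q S) (λ T → ⟦ ((c ∷ []) ∷ I) ≟S T ⟧) ≡ ⟦ (c ∷ []) ≟W⁺ q ⟧ * ⟦ I ≟S S ⟧
  ∑-merge-letter q []      c I = trans (+-identityʳ _) (⟦∷⟧ (c ∷ []) I q [])
  ∑-merge-letter q (s ∷ S) c I = trans
    (cong₂ _+_ (⟦∷⟧ (c ∷ []) I q (s ∷ S))
      (cong (_+ 0ℚ) (⟦⟧-no (((c ∷ []) ∷ I) ≟S ((q ⁺++⁺ s) ∷ S)) (letter≢⁺++⁺ q s ∘ List.∷-injectiveˡ))))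
    (+-identityʳ _)

  ∑-coarsenings-letter : ∀ q Q c I →
    ∑ (coarsenings (q ∷ Q)) (λ T → ⟦ ((c ∷ []) ∷ I) ≟S T ⟧) ≡
    ⟦ (c ∷ []) ≟W⁺ q ⟧ * ∑ (coarsenings Q) (λ S → ⟦ I ≟S S ⟧)
  ∑-coarsenings-letter q Q c I = trans (∑-coarsenings-∷ q Q _)
    (trans (∑-cong (coarsenings Q) (λ S → ∑-merge-letter q S c I)) (sym (∑-*ˡ ⟦ (c ∷ []) ≟W⁺ q ⟧ (coarsenings Q) _)))

  -- The word `c ∷⁺ w` has at least two letters, so deleting the first one loses no word of the
  -- coarsening. If `ds` is empty, `d` must have been merged with its successor, and after the
  -- deletion nothing is left to merge: this is the first clause of `merge′`.
  ∑-coarsenings-attach : ∀ d ds P c w I →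
    ∑ (coarsenings ((d ∷ ds) ∷ P)) (λ T → ⟦ ((c ∷⁺ w) ∷ I) ≟S T ⟧) ≡
    ⟦ d ≟C c ⟧ * ∑ (coarsenings (word ds ++ P)) (λ T → ⟦ (w ∷ I) ≟S T ⟧)
  ∑-coarsenings-attach d ds P c w I = begin
    ∑ (coarsenings ((d ∷ ds) ∷ P)) (λ T → ⟦ ((c ∷⁺ w) ∷ I) ≟S T ⟧)
      ≡⟨ ∑-coarsenings-∷ (d ∷ ds) P (λ T → ⟦ ((c ∷⁺ w) ∷ I) ≟S T ⟧) ⟩
    ∑ (coarsenings P) (λ S → ∑ (merge (d ∷ ds) S) (λ T → ⟦ ((c ∷⁺ w) ∷ I) ≟S T ⟧))
      ≡⟨ ∑-cong (coarsenings P) (merged ds) ⟩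
    ∑ (coarsenings P) (λ S → ⟦ d ≟C c ⟧ * ∑ (merge′ ds S) (λ T → ⟦ (w ∷ I) ≟S T ⟧))
      ≡⟨ sym (∑-*ˡ ⟦ d ≟C c ⟧ (coarsenings P) _) ⟩
    ⟦ d ≟C c ⟧ * ∑ (coarsenings P) (λ S → ∑ (merge′ ds S) (λ T → ⟦ (w ∷ I) ≟S T ⟧))
      ≡⟨ cong (⟦ d ≟C c ⟧ *_) (unmerge ds) ⟩
    ⟦ d ≟C c ⟧ * ∑ (coarsenings (word ds ++ P)) (λ T → ⟦ (w ∷ I) ≟S T ⟧) ∎
    where
    merge′ : Word {n} → Sentence {n} → List (Sentence {n})
    merge′ []       S = S ∷ []
    merge′ (e ∷ es) S = merge (e ∷ es) S
    unmerge : ∀ ds → ∑ (coarsenings P) (λ S → ∑ (merge′ ds S) (λ T → ⟦ (w ∷ I) ≟S T ⟧)) ≡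
                     ∑ (coarsenings (word ds ++ P)) (λ T → ⟦ (w ∷ I) ≟S T ⟧)
    unmerge []       = ∑-cong (coarsenings P) (λ S → +-identityʳ _)
    unmerge (e ∷ es) = sym (∑-coarsenings-∷ (e ∷ es) P (λ T → ⟦ (w ∷ I) ≟S T ⟧))
    same : ∀ v S → ⟦ ((c ∷⁺ w) ∷ I) ≟S ((d ∷⁺ v) ∷ S) ⟧ ≡ ⟦ d ≟C c ⟧ * ⟦ (w ∷ I) ≟S (v ∷ S) ⟧
    same v S = ⟦⟧-× (((c ∷⁺ w) ∷ I) ≟S ((d ∷⁺ v) ∷ S)) (d ≟C c) ((w ∷ I) ≟S (v ∷ S))
      (λ { refl → refl , refl }) (λ { refl refl → refl })
    merged : ∀ ds S → ∑ (merge (d ∷ ds) S) (λ T → ⟦ ((c ∷⁺ w) ∷ I) ≟S T ⟧) ≡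
                      ⟦ d ≟C c ⟧ * ∑ (merge′ ds S) (λ T → ⟦ (w ∷ I) ≟S T ⟧)
    merged [] []            = trans (cong (_+ 0ℚ) (⟦⟧-no (((c ∷⁺ w) ∷ I) ≟S ((d ∷ []) ∷ [])) (λ ())))
      (sym (*-zeroʳ ⟦ d ≟C c ⟧))
    merged [] (s ∷ S)       = begin
      ⟦ ((c ∷⁺ w) ∷ I) ≟S ((d ∷ []) ∷ s ∷ S) ⟧ + (⟦ ((c ∷⁺ w) ∷ I) ≟S ((d ∷⁺ s) ∷ S) ⟧ + 0ℚ)
        ≡⟨ cong₂ _+_ (⟦⟧-no (((c ∷⁺ w) ∷ I) ≟S ((d ∷ []) ∷ s ∷ S)) (λ ()))
             (trans (+-identityʳ ⟦ ((c ∷⁺ w) ∷ I) ≟S ((d ∷⁺ s) ∷ S) ⟧) (same s S)) ⟩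
      0ℚ + ⟦ d ≟C c ⟧ * ⟦ (w ∷ I) ≟S (s ∷ S) ⟧
        ≡⟨ solve 2 (λ a b → con 0ℚ :+ a :* b := a :* (b :+ con 0ℚ)) refl ⟦ d ≟C c ⟧ ⟦ (w ∷ I) ≟S (s ∷ S) ⟧ ⟩
      ⟦ d ≟C c ⟧ * (⟦ (w ∷ I) ≟S (s ∷ S) ⟧ + 0ℚ) ∎
    merged (e ∷ es) []      = trans (cong (_+ 0ℚ) (same (e ∷ es) []))
      (solve 2 (λ a b → a :* b :+ con 0ℚ := a :* (b :+ con 0ℚ)) refl ⟦ d ≟C c ⟧ ⟦ (w ∷ I) ≟S ((e ∷ es) ∷ []) ⟧)
    merged (e ∷ es) (s ∷ S) = trans (cong₂ _+_ (same (e ∷ es) (s ∷ S)) (cong (_+ 0ℚ) (same ((e ∷ es) ⁺++⁺ s) S)))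
      (solve 3 (λ a b b′ → a :* b :+ (a :* b′ :+ con 0ℚ) := a :* (b :+ (b′ :+ con 0ℚ))) refl
        ⟦ d ≟C c ⟧ ⟦ (w ∷ I) ≟S ((e ∷ es) ∷ s ∷ S) ⟧ ⟦ (w ∷ I) ≟S (((e ∷ es) ⁺++⁺ s) ∷ S) ⟧)

  -- Both sides test whether `Q` ⪯ `I`. First letters are deleted from `Q` and `I` together; the
  -- companion lemma descends inside the first word of `I` and returns here when that word is used
  -- up.
  ∑-coarsenings-refine : ∀ I Q →
    ∑ (coarsenings Q) (λ S → ⟦ I ≟S S ⟧) ≡ ∑ (refine I) (λ R → ⟦ Q ≟S R ⟧)
  ∑-coarsenings-refine-∷ : ∀ c cs I Q →
    ∑ (coarsenings Q) (λ S → ⟦ ((c ∷ cs) ∷ I) ≟S S ⟧) ≡ ∑ (refine ((c ∷ cs) ∷ I)) (λ R → ⟦ Q ≟S R ⟧)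

  ∑-coarsenings-refine []             []      = refl
  ∑-coarsenings-refine []             (q ∷ Q) = trans (∑-coarsenings-∷ q Q _)
    (∑-zero (coarsenings Q) (λ { [] → refl ; (_ ∷ _) → refl }))
  ∑-coarsenings-refine ((c ∷ cs) ∷ I) Q       = ∑-coarsenings-refine-∷ c cs I Q

  ∑-coarsenings-refine-∷ c [] I [] =
    sym (trans (∑-refine-letter c I (λ R → ⟦ [] ≟S R ⟧)) (∑-zero (refine I) (λ _ → refl)))
  ∑-coarsenings-refine-∷ c [] I (q ∷ Q) = begin
    ∑ (coarsenings (q ∷ Q)) (λ S → ⟦ ((c ∷ []) ∷ I) ≟S S ⟧)
      ≡⟨ ∑-coarsenings-letter q Q c I ⟩
    ⟦ (c ∷ []) ≟W⁺ q ⟧ * ∑ (coarsenings Q) (λ S → ⟦ I ≟S S ⟧)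
      ≡⟨ cong₂ _*_ (⟦⟧-⇔ ((c ∷ []) ≟W⁺ q) (q ≟W⁺ (c ∷ [])) sym sym) (∑-coarsenings-refine I Q) ⟩
    ⟦ q ≟W⁺ (c ∷ []) ⟧ * ∑ (refine I) (λ R → ⟦ Q ≟S R ⟧)
      ≡⟨ trans (∑-*ˡ ⟦ q ≟W⁺ (c ∷ []) ⟧ (refine I) _) (∑-cong (refine I) (λ R → sym (⟦∷⟧ q Q (c ∷ []) R))) ⟩
    ∑ (refine I) (λ R → ⟦ (q ∷ Q) ≟S ((c ∷ []) ∷ R) ⟧)
      ≡⟨ sym (∑-refine-letter c I (λ R → ⟦ (q ∷ Q) ≟S R ⟧)) ⟩
    ∑ (refine ((c ∷ []) ∷ I)) (λ R → ⟦ (q ∷ Q) ≟S R ⟧) ∎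
  ∑-coarsenings-refine-∷ c (e ∷ es) I [] =
    sym (trans (∑-refine-attach c e es I (λ R → ⟦ [] ≟S R ⟧)) (∑-zero (refine ((e ∷ es) ∷ I)) (∑-attach-[] c)))
  ∑-coarsenings-refine-∷ c (e ∷ es) I ((d ∷ ds) ∷ P) = begin
    ∑ (coarsenings ((d ∷ ds) ∷ P)) (λ S → ⟦ ((c ∷ e ∷ es) ∷ I) ≟S S ⟧)
      ≡⟨ ∑-coarsenings-attach d ds P c (e ∷ es) I ⟩
    ⟦ d ≟C c ⟧ * ∑ (coarsenings (word ds ++ P)) (λ S → ⟦ ((e ∷ es) ∷ I) ≟S S ⟧)
      ≡⟨ cong (⟦ d ≟C c ⟧ *_) (∑-coarsenings-refine-∷ e es I (word ds ++ P)) ⟩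
    ⟦ d ≟C c ⟧ * ∑ (refine ((e ∷ es) ∷ I)) (λ R → ⟦ (word ds ++ P) ≟S R ⟧)
      ≡⟨ trans (∑-*ˡ ⟦ d ≟C c ⟧ (refine ((e ∷ es) ∷ I)) _)
           (∑-cong (refine ((e ∷ es) ∷ I)) (λ R → sym (∑-attach c R d ds P))) ⟩
    ∑ (refine ((e ∷ es) ∷ I)) (λ R → ∑ (attach c R) (λ R → ⟦ ((d ∷ ds) ∷ P) ≟S R ⟧))
      ≡⟨ sym (∑-refine-attach c e es I (λ R → ⟦ ((d ∷ ds) ∷ P) ≟S R ⟧)) ⟩
    ∑ (refine ((c ∷ e ∷ es) ∷ I)) (λ R → ⟦ ((d ∷ ds) ∷ P) ≟S R ⟧) ∎

  -- The quasi-shuffle product as the transpose of the coproduct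

  -- Head and tail are separate arguments because the recursion is not structural on a List⁺.
  properSplits : Fin n → Word {n} → List (NWord {n} × NWord {n})
  properSplits c []       = []
  properSplits c (d ∷ ds) = ((c ∷ []) , (d ∷ ds)) ∷ map (map₁ (c ∷⁺_)) (properSplits d ds)

  ∑-properSplits-∷ : ∀ c d ds (G : NWord {n} → NWord {n} → ℚ) →
    ∑ (properSplits c (d ∷ ds)) (λ (x , y) → G x y) ≡
    G (c ∷ []) (d ∷ ds) + ∑ (properSplits d ds) (λ (x , y) → G (c ∷⁺ x) y)
  ∑-properSplits-∷ c d ds G = cong (G (c ∷ []) (d ∷ ds) +_) (∑-map (map₁ (c ∷⁺_)) (properSplits d ds) _)

  -- The three summands correspond to the branches of `qsh`: the word comes from the right factor
  -- alone, from a merger, or from the left factor alone.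
  ∑-splits-properSplits : ∀ c cs (G : Word {n} → Word {n} → ℚ) →
    ∑ (splits (c ∷ cs)) (λ (x , y) → G x y) ≡
    G [] (c ∷ cs) + (∑ (properSplits c cs) (λ (x , y) → G (toList x) (toList y)) + G (c ∷ cs) [])
  ∑-splits-properSplits c []       G = cong (G [] (c ∷ []) +_) (+-comm (G (c ∷ []) []) 0ℚ)
  ∑-splits-properSplits c (d ∷ ds) G = begin
    ∑ (splits (c ∷ d ∷ ds)) (λ (x , y) → G x y)
      ≡⟨ ∑-splits-∷ c (d ∷ ds) G ⟩
    G [] (c ∷ d ∷ ds) + ∑ (splits (d ∷ ds)) (λ (x , y) → G (c ∷ x) y)
      ≡⟨ cong (G [] (c ∷ d ∷ ds) +_) (∑-splits-properSplits d ds (G ∘ (c ∷_))) ⟩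
    G [] (c ∷ d ∷ ds) + (G (c ∷ []) (d ∷ ds) +
      (∑ (properSplits d ds) (λ (x , y) → G (c ∷ toList x) (toList y)) + G (c ∷ d ∷ ds) []))
      ≡⟨ cong (G [] (c ∷ d ∷ ds) +_) (sym (+-assoc (G (c ∷ []) (d ∷ ds)) _ (G (c ∷ d ∷ ds) []))) ⟩
    G [] (c ∷ d ∷ ds) + (G (c ∷ []) (d ∷ ds) +
      ∑ (properSplits d ds) (λ (x , y) → G (c ∷ toList x) (toList y)) + G (c ∷ d ∷ ds) [])
      ≡⟨ cong (λ a → G [] (c ∷ d ∷ ds) + (a + G (c ∷ d ∷ ds) []))
           (sym (∑-properSplits-∷ c d ds (λ x y → G (toList x) (toList y)))) ⟩
    G [] (c ∷ d ∷ ds) + (∑ (properSplits c (d ∷ ds)) (λ (x , y) → G (toList x) (toList y)) + G (c ∷ d ∷ ds) []) ∎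

  ∑-properSplits : ∀ c cs a b →
    ∑ (properSplits c cs) (λ (x , y) → ⟦ x ≟W⁺ a ⟧ * ⟦ y ≟W⁺ b ⟧) ≡ ⟦ (c ∷ cs) ≟W⁺ (a ⁺++⁺ b) ⟧
  ∑-properSplits c []       a b = sym (⟦⟧-no ((c ∷ []) ≟W⁺ (a ⁺++⁺ b)) (letter≢⁺++⁺ a b))
  ∑-properSplits c (d ∷ ds) (a ∷ []) b = begin
    ∑ (properSplits c (d ∷ ds)) (λ (x , y) → ⟦ x ≟W⁺ (a ∷ []) ⟧ * ⟦ y ≟W⁺ b ⟧)
      ≡⟨ ∑-properSplits-∷ c d ds (λ x y → ⟦ x ≟W⁺ (a ∷ []) ⟧ * ⟦ y ≟W⁺ b ⟧) ⟩
    ⟦ (c ∷ []) ≟W⁺ (a ∷ []) ⟧ * ⟦ (d ∷ ds) ≟W⁺ b ⟧ +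
      ∑ (properSplits d ds) (λ (x , y) → ⟦ (c ∷⁺ x) ≟W⁺ (a ∷ []) ⟧ * ⟦ y ≟W⁺ b ⟧)
      ≡⟨ cong₂ _+_ (sym (⟦⟧-× ((c ∷ d ∷ ds) ≟W⁺ (a ∷ toList b)) ((c ∷ []) ≟W⁺ (a ∷ [])) ((d ∷ ds) ≟W⁺ b)
           (λ { refl → refl , refl }) (λ { refl refl → refl })))
           (∑-zero (properSplits d ds) (λ (x , y) → trans
             (cong (_* ⟦ y ≟W⁺ b ⟧) (⟦⟧-no ((c ∷⁺ x) ≟W⁺ (a ∷ [])) (λ ()))) (*-zeroˡ ⟦ y ≟W⁺ b ⟧))) ⟩
    ⟦ (c ∷ d ∷ ds) ≟W⁺ (a ∷ toList b) ⟧ + 0ℚ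
      ≡⟨ +-identityʳ _ ⟩
    ⟦ (c ∷ d ∷ ds) ≟W⁺ (a ∷ toList b) ⟧ ∎
  ∑-properSplits c (d ∷ ds) (a ∷ e ∷ es) b = begin
    ∑ (properSplits c (d ∷ ds)) (λ (x , y) → ⟦ x ≟W⁺ (a ∷ e ∷ es) ⟧ * ⟦ y ≟W⁺ b ⟧)
      ≡⟨ ∑-properSplits-∷ c d ds (λ x y → ⟦ x ≟W⁺ (a ∷ e ∷ es) ⟧ * ⟦ y ≟W⁺ b ⟧) ⟩
    ⟦ (c ∷ []) ≟W⁺ (a ∷ e ∷ es) ⟧ * ⟦ (d ∷ ds) ≟W⁺ b ⟧ +
      ∑ (properSplits d ds) (λ (x , y) → ⟦ (c ∷⁺ x) ≟W⁺ (a ∷ e ∷ es) ⟧ * ⟦ y ≟W⁺ b ⟧)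
      ≡⟨ cong₂ _+_ (trans (cong (_* ⟦ (d ∷ ds) ≟W⁺ b ⟧) (⟦⟧-no ((c ∷ []) ≟W⁺ (a ∷ e ∷ es)) (λ ()))) (*-zeroˡ ⟦ (d ∷ ds) ≟W⁺ b ⟧))
           (∑-cong (properSplits d ds) (λ (x , y) → trans (cong (_* ⟦ y ≟W⁺ b ⟧)
             (⟦⟧-× ((c ∷⁺ x) ≟W⁺ (a ∷ e ∷ es)) (c ≟C a) (x ≟W⁺ (e ∷ es)) (λ { refl → refl , refl }) (λ { refl refl → refl })))
             (*-assoc ⟦ c ≟C a ⟧ _ _))) ⟩
    0ℚ + ∑ (properSplits d ds) (λ (x , y) → ⟦ c ≟C a ⟧ * (⟦ x ≟W⁺ (e ∷ es) ⟧ * ⟦ y ≟W⁺ b ⟧))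
      ≡⟨ trans (+-identityˡ _) (sym (∑-*ˡ ⟦ c ≟C a ⟧ (properSplits d ds) _)) ⟩
    ⟦ c ≟C a ⟧ * ∑ (properSplits d ds) (λ (x , y) → ⟦ x ≟W⁺ (e ∷ es) ⟧ * ⟦ y ≟W⁺ b ⟧)
      ≡⟨ cong (⟦ c ≟C a ⟧ *_) (∑-properSplits d ds (e ∷ es) b) ⟩
    ⟦ c ≟C a ⟧ * ⟦ (d ∷ ds) ≟W⁺ ((e ∷ es) ⁺++⁺ b) ⟧
      ≡⟨ sym (⟦⟧-× ((c ∷ d ∷ ds) ≟W⁺ (a ∷ e ∷ es ++ toList b)) (c ≟C a) ((d ∷ ds) ≟W⁺ ((e ∷ es) ⁺++⁺ b))
           (λ { refl → refl , refl }) (λ { refl refl → refl })) ⟩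
    ⟦ (c ∷ d ∷ ds) ≟W⁺ (a ∷ e ∷ es ++ toList b) ⟧ ∎

  ∑-map-∷ : ∀ (w : NWord {n}) I a L →
    ∑ (map (a ∷_) L) (λ K → ⟦ (w ∷ I) ≟S K ⟧) ≡ ⟦ w ≟W⁺ a ⟧ * ∑ L (λ K → ⟦ I ≟S K ⟧)
  ∑-map-∷ w I a L = trans (∑-map (a ∷_) L _)
    (trans (∑-cong L (λ K → ⟦∷⟧ w I a K)) (sym (∑-*ˡ ⟦ w ≟W⁺ a ⟧ L _)))

  -- The coefficient of H_J ⊗ H_S in Δ(H_I).
  cutCount : Sentence {n} → Sentence {n} → Sentence {n} → ℚ
  cutCount I J S = ∑ (cut I) (λ (I₁ , I₂) → ⟦ I₁ ≟S J ⟧ * ⟦ I₂ ≟S S ⟧)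

  cutCount-∷ : ∀ c cs I J S → cutCount ((c ∷ cs) ∷ I) J S ≡
    ∑ (cut I) (λ (I₁ , I₂) → ⟦ I₁ ≟S J ⟧ * ⟦ ((c ∷ cs) ∷ I₂) ≟S S ⟧) +
    (∑ (properSplits c cs) (λ (x , y) → ∑ (cut I) (λ (I₁ , I₂) → ⟦ (x ∷ I₁) ≟S J ⟧ * ⟦ (y ∷ I₂) ≟S S ⟧)) +
     ∑ (cut I) (λ (I₁ , I₂) → ⟦ ((c ∷ cs) ∷ I₁) ≟S J ⟧ * ⟦ I₂ ≟S S ⟧))
  cutCount-∷ c cs I J S = trans (∑-cut-∷ (c ∷ cs) I (λ I₁ I₂ → ⟦ I₁ ≟S J ⟧ * ⟦ I₂ ≟S S ⟧))
    (∑-splits-properSplits c cs (λ x y →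
      ∑ (cut I) (λ (I₁ , I₂) → ⟦ (word x ++ I₁) ≟S J ⟧ * ⟦ (word y ++ I₂) ≟S S ⟧)))

  ∑-cut-∷ˡ : ∀ (w : NWord {n}) I a J S →
    ∑ (cut I) (λ (I₁ , I₂) → ⟦ (w ∷ I₁) ≟S (a ∷ J) ⟧ * ⟦ I₂ ≟S S ⟧) ≡ ⟦ w ≟W⁺ a ⟧ * cutCount I J S
  ∑-cut-∷ˡ w I a J S = trans
    (∑-cong (cut I) (λ (I₁ , I₂) → trans (cong (_* ⟦ I₂ ≟S S ⟧) (⟦∷⟧ w I₁ a J)) (*-assoc ⟦ w ≟W⁺ a ⟧ _ _)))
    (sym (∑-*ˡ ⟦ w ≟W⁺ a ⟧ (cut I) _))

  ∑-cut-∷ʳ : ∀ (w : NWord {n}) I J b S →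
    ∑ (cut I) (λ (I₁ , I₂) → ⟦ I₁ ≟S J ⟧ * ⟦ (w ∷ I₂) ≟S (b ∷ S) ⟧) ≡ ⟦ w ≟W⁺ b ⟧ * cutCount I J S
  ∑-cut-∷ʳ w I J b S = trans
    (∑-cong (cut I) (λ (I₁ , I₂) → trans (cong (⟦ I₁ ≟S J ⟧ *_) (⟦∷⟧ w I₂ b S))
      (solve 3 (λ a b c → a :* (b :* c) := b :* (a :* c)) refl ⟦ I₁ ≟S J ⟧ ⟦ w ≟W⁺ b ⟧ ⟦ I₂ ≟S S ⟧)))
    (sym (∑-*ˡ ⟦ w ≟W⁺ b ⟧ (cut I) _))

  ∑-properSplits-cut : ∀ c cs I a J b S →
    ∑ (properSplits c cs) (λ (x , y) → ∑ (cut I) (λ (I₁ , I₂) →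
      ⟦ (x ∷ I₁) ≟S (a ∷ J) ⟧ * ⟦ (y ∷ I₂) ≟S (b ∷ S) ⟧)) ≡
    ⟦ (c ∷ cs) ≟W⁺ (a ⁺++⁺ b) ⟧ * cutCount I J S
  ∑-properSplits-cut c cs I a J b S = begin
    ∑ (properSplits c cs) (λ (x , y) → ∑ (cut I) (λ (I₁ , I₂) →
      ⟦ (x ∷ I₁) ≟S (a ∷ J) ⟧ * ⟦ (y ∷ I₂) ≟S (b ∷ S) ⟧))
      ≡⟨ ∑-cong (properSplits c cs) (λ (x , y) → trans
           (∑-cong (cut I) (λ (I₁ , I₂) → trans (cong₂ _*_ (⟦∷⟧ x I₁ a J) (⟦∷⟧ y I₂ b S))
             (solve 4 (λ a b c d → (a :* b) :* (c :* d) := (a :* c) :* (b :* d)) refl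
               ⟦ x ≟W⁺ a ⟧ ⟦ I₁ ≟S J ⟧ ⟦ y ≟W⁺ b ⟧ ⟦ I₂ ≟S S ⟧)))
           (sym (∑-*ˡ (⟦ x ≟W⁺ a ⟧ * ⟦ y ≟W⁺ b ⟧) (cut I) _))) ⟩
    ∑ (properSplits c cs) (λ (x , y) → ⟦ x ≟W⁺ a ⟧ * ⟦ y ≟W⁺ b ⟧ * cutCount I J S)
      ≡⟨ sym (∑-*ʳ (cutCount I J S) (properSplits c cs) _) ⟩
    ∑ (properSplits c cs) (λ (x , y) → ⟦ x ≟W⁺ a ⟧ * ⟦ y ≟W⁺ b ⟧) * cutCount I J S
      ≡⟨ cong (_* cutCount I J S) (∑-properSplits c cs a b) ⟩
    ⟦ (c ∷ cs) ≟W⁺ (a ⁺++⁺ b) ⟧ * cutCount I J S ∎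

  ∑-cut-zeroˡ : ∀ (w : NWord {n}) I S → ∑ (cut I) (λ (I₁ , I₂) → ⟦ (w ∷ I₁) ≟S [] ⟧ * ⟦ I₂ ≟S S ⟧) ≡ 0ℚ
  ∑-cut-zeroˡ w I S = ∑-zero (cut I) (λ (I₁ , I₂) → *-zeroˡ ⟦ I₂ ≟S S ⟧)

  ∑-cut-zeroʳ : ∀ (w : NWord {n}) I J → ∑ (cut I) (λ (I₁ , I₂) → ⟦ I₁ ≟S J ⟧ * ⟦ (w ∷ I₂) ≟S [] ⟧) ≡ 0ℚ
  ∑-cut-zeroʳ w I J = ∑-zero (cut I) (λ (I₁ , I₂) → *-zeroʳ ⟦ I₁ ≟S J ⟧)

  -- The duality ⟨H_I, M_J M_S⟩ = ⟨Δ(H_I), M_J ⊗ M_S⟩, by following the first word of `I`.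
  ∑-qsh-cut : ∀ I J S → ∑ (qsh J S) (λ L → ⟦ I ≟S L ⟧) ≡ cutCount I J S
  ∑-qsh-cut []      []      []      = refl
  ∑-qsh-cut []      []      (b ∷ S) = refl
  ∑-qsh-cut []      (a ∷ J) []      = refl
  ∑-qsh-cut []      (a ∷ J) (b ∷ S) = begin
    ∑ (qsh (a ∷ J) (b ∷ S)) (λ L → ⟦ [] ≟S L ⟧)
      ≡⟨ trans (∑-++ (map (a ∷_) (qsh J (b ∷ S))) _ _)
           (cong₂ _+_ (none a (qsh J (b ∷ S))) (trans (∑-++ (map (b ∷_) (qsh (a ∷ J) S)) _ _)
             (cong₂ _+_ (none b (qsh (a ∷ J) S)) (none (a ⁺++⁺ b) (qsh J S))))) ⟩
    0ℚ + (0ℚ + 0ℚ) ∎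
    where
    none : ∀ a L → ∑ (map (a ∷_) L) (λ L → ⟦ [] ≟S L ⟧) ≡ 0ℚ
    none a L = trans (∑-map (a ∷_) L _) (∑-zero L (λ _ → refl))
  ∑-qsh-cut ((c ∷ cs) ∷ I) []      []      = sym (trans (cutCount-∷ c cs I [] [])
    (cong₂ _+_ (∑-cut-zeroʳ (c ∷ cs) I []) (cong₂ _+_
      (∑-zero (properSplits c cs) (λ (x , y) → ∑-zero (cut I) (λ (I₁ , I₂) → refl)))
      (∑-cut-zeroˡ (c ∷ cs) I []))))
  ∑-qsh-cut ((c ∷ cs) ∷ I) []      (b ∷ S) = begin
    ⟦ ((c ∷ cs) ∷ I) ≟S (b ∷ S) ⟧ + 0ℚ
      ≡⟨ ∑-map-∷ (c ∷ cs) I b (S ∷ []) ⟩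
    ⟦ (c ∷ cs) ≟W⁺ b ⟧ * ∑ (qsh [] S) (λ L → ⟦ I ≟S L ⟧)
      ≡⟨ cong (⟦ (c ∷ cs) ≟W⁺ b ⟧ *_) (∑-qsh-cut I [] S) ⟩
    ⟦ (c ∷ cs) ≟W⁺ b ⟧ * cutCount I [] S
      ≡⟨ sym (+-identityʳ _) ⟩
    ⟦ (c ∷ cs) ≟W⁺ b ⟧ * cutCount I [] S + (0ℚ + 0ℚ)
      ≡⟨ sym (cong₂ _+_ (∑-cut-∷ʳ (c ∷ cs) I [] b S) (cong₂ _+_
           (∑-zero (properSplits c cs) (λ (x , y) → ∑-zero (cut I) (λ (I₁ , I₂) → *-zeroˡ ⟦ (y ∷ I₂) ≟S (b ∷ S) ⟧)))
           (∑-cut-zeroˡ (c ∷ cs) I (b ∷ S)))) ⟩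
    _ ≡⟨ sym (cutCount-∷ c cs I [] (b ∷ S)) ⟩
    cutCount ((c ∷ cs) ∷ I) [] (b ∷ S) ∎
  ∑-qsh-cut ((c ∷ cs) ∷ I) (a ∷ J) []      = begin
    ⟦ ((c ∷ cs) ∷ I) ≟S (a ∷ J) ⟧ + 0ℚ
      ≡⟨ ∑-map-∷ (c ∷ cs) I a (J ∷ []) ⟩
    ⟦ (c ∷ cs) ≟W⁺ a ⟧ * (⟦ I ≟S J ⟧ + 0ℚ)
      ≡⟨ cong (⟦ (c ∷ cs) ≟W⁺ a ⟧ *_) (trans (qsh-[] J) (∑-qsh-cut I J [])) ⟩
    ⟦ (c ∷ cs) ≟W⁺ a ⟧ * cutCount I J []
      ≡⟨ solve 1 (λ x → x := con 0ℚ :+ (con 0ℚ :+ x)) refl (⟦ (c ∷ cs) ≟W⁺ a ⟧ * cutCount I J []) ⟩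
    0ℚ + (0ℚ + ⟦ (c ∷ cs) ≟W⁺ a ⟧ * cutCount I J [])
      ≡⟨ sym (cong₂ _+_ (∑-cut-zeroʳ (c ∷ cs) I (a ∷ J)) (cong₂ _+_
           (∑-zero (properSplits c cs) (λ (x , y) → ∑-zero (cut I) (λ (I₁ , I₂) → *-zeroʳ ⟦ (x ∷ I₁) ≟S (a ∷ J) ⟧)))
           (∑-cut-∷ˡ (c ∷ cs) I a J []))) ⟩
    _ ≡⟨ sym (cutCount-∷ c cs I (a ∷ J) []) ⟩
    cutCount ((c ∷ cs) ∷ I) (a ∷ J) [] ∎
    where
    qsh-[] : ∀ J → ⟦ I ≟S J ⟧ + 0ℚ ≡ ∑ (qsh J []) (λ L → ⟦ I ≟S L ⟧)
    qsh-[] []      = refl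
    qsh-[] (_ ∷ _) = refl
  ∑-qsh-cut ((c ∷ cs) ∷ I) (a ∷ J) (b ∷ S) = begin
    ∑ (qsh (a ∷ J) (b ∷ S)) (λ L → ⟦ ((c ∷ cs) ∷ I) ≟S L ⟧)
      ≡⟨ trans (∑-++ (map (a ∷_) (qsh J (b ∷ S))) _ _)
           (cong₂ _+_ (part a J (b ∷ S)) (trans (∑-++ (map (b ∷_) (qsh (a ∷ J) S)) _ _)
             (cong₂ _+_ (part b (a ∷ J) S) (part (a ⁺++⁺ b) J S)))) ⟩
    x + (y + z)
      -- `qsh` lists left, right, merged; `cutCount-∷` lists right, merged, left.
      ≡⟨ solve 3 (λ x y z → x :+ (y :+ z) := y :+ (z :+ x)) refl x y z ⟩
    y + (z + x)
      ≡⟨ sym (cong₂ _+_ (∑-cut-∷ʳ (c ∷ cs) I (a ∷ J) b S) (cong₂ _+_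
           (∑-properSplits-cut c cs I a J b S)
           (∑-cut-∷ˡ (c ∷ cs) I a J (b ∷ S)))) ⟩
    _ ≡⟨ sym (cutCount-∷ c cs I (a ∷ J) (b ∷ S)) ⟩
    cutCount ((c ∷ cs) ∷ I) (a ∷ J) (b ∷ S) ∎
    where
    x y z : ℚ
    x = ⟦ (c ∷ cs) ≟W⁺ a ⟧ * cutCount I J (b ∷ S)
    y = ⟦ (c ∷ cs) ≟W⁺ b ⟧ * cutCount I (a ∷ J) S
    z = ⟦ (c ∷ cs) ≟W⁺ (a ⁺++⁺ b) ⟧ * cutCount I J S
    part : ∀ w J S → ∑ (map (w ∷_) (qsh J S)) (λ L → ⟦ ((c ∷ cs) ∷ I) ≟S L ⟧) ≡ ⟦ (c ∷ cs) ≟W⁺ w ⟧ * cutCount I J S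
    part w J S = trans (∑-map-∷ (c ∷ cs) I w (qsh J S)) (cong (⟦ (c ∷ cs) ≟W⁺ w ⟧ *_) (∑-qsh-cut I J S))

  countQ-∑ : ∀ (K : Sentence {n}) Ls → countQ K Ls ≡ ∑ Ls (λ L → ⟦ K ≟S L ⟧)
  countQ-∑ K []       = refl
  countQ-∑ K (L ∷ Ls) with K ≟S L
  ... | yes _ = cong (1ℚ +_) (countQ-∑ K Ls)
  ... | no _  = trans (countQ-∑ K Ls) (sym (+-identityˡ _))

  -- Size bounds for the truncated enumerations

  cut-size : ∀ I → All (λ (I₁ , I₂) → size I₁ ℕ.+ size I₂ ≡ size I) (cut I)
  cut-size []      = refl ∷ []
  cut-size (w ∷ I) = All.concat⁺ (All.map⁺ (All.map (λ {s} e →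
    All.map⁺ (All.map (λ {K} → step s e K) (cut-size I))) (splits-++ (toList w))))
    where
    step : ∀ ((x , y) : Word {n} × Word {n}) → x ++ y ≡ toList w →
      ∀ ((I₁ , I₂) : Sentence {n} × Sentence {n}) → size I₁ ℕ.+ size I₂ ≡ size I →
      size (word x ++ I₁) ℕ.+ size (word y ++ I₂) ≡ size (w ∷ I)
    step (x , y) e (I₁ , I₂) e′ = begin
      size (word x ++ I₁) ℕ.+ size (word y ++ I₂)
        ≡⟨ cong₂ ℕ._+_ (size-word-++ x I₁) (size-word-++ y I₂) ⟩
      (length x ℕ.+ size I₁) ℕ.+ (length y ℕ.+ size I₂)
        ≡⟨ interchange (length x) (size I₁) (length y) (size I₂) ⟩
      (length x ℕ.+ length y) ℕ.+ (size I₁ ℕ.+ size I₂)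
        ≡⟨ cong₂ ℕ._+_ (trans (sym (List.length-++ x)) (cong length e)) e′ ⟩
      size (w ∷ I) ∎

  factorizations-size : ∀ w → All (λ Q → size Q ≡ length w) (factorizations {n} w)
  factorizations-size []       = refl ∷ []
  factorizations-size (c ∷ cs) = All.concat⁺ (All.map⁺ (All.map (λ {Q} → attached Q) (factorizations-size cs)))
    where
    attached : ∀ Q → size Q ≡ length cs → All (λ R → size R ≡ suc (length cs)) _
    attached []      e = cong suc e ∷ []
    attached (_ ∷ _) e = cong suc e ∷ cong suc e ∷ []

  refine-size : ∀ I → All (λ R → size R ≡ size I) (refine I)
  refine-size []      = refl ∷ []
  refine-size (w ∷ I) = All.concat⁺ (All.map⁺ (All.map (λ {Q} e →
    All.map⁺ (All.map (λ {R} e′ → trans (size-++ Q R) (cong₂ ℕ._+_ e e′)) (refine-size I))) (factorizations-size (toList w))))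

  -- No `I₁` in a cut of `I` has more letters than `I`, so the range of `J` in `perpR` meets each
  -- `I₁` exactly once.
  ∑-pairHMM : ∀ I S (k : Sentence {n} → ℚ) →
    ∑ (sentencesUpTo (size I)) (λ J → pairHMM I J S * k J) ≡ ∑ (cut I) (λ (I₁ , I₂) → ⟦ I₂ ≟S S ⟧ * k I₁)
  ∑-pairHMM I S k = begin
    ∑ (sentencesUpTo (size I)) (λ J → pairHMM I J S * k J)
      ≡⟨ ∑-cong (sentencesUpTo (size I)) (λ J → trans
           (cong (_* k J) (trans (countQ-∑ I (qsh J S)) (∑-qsh-cut I J S)))
           (trans (∑-*ʳ (k J) (cut I) _) (∑-cong (cut I) (λ (I₁ , I₂) →
             solve 3 (λ a b c → a :* b :* c := b :* (a :* c)) refl ⟦ I₁ ≟S J ⟧ ⟦ I₂ ≟S S ⟧ (k J))))) ⟩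
    ∑ (sentencesUpTo (size I)) (λ J → ∑ (cut I) (λ (I₁ , I₂) → ⟦ I₂ ≟S S ⟧ * (⟦ I₁ ≟S J ⟧ * k J)))
      ≡⟨ ∑-swap (sentencesUpTo (size I)) (cut I) _ ⟩
    ∑ (cut I) (λ (I₁ , I₂) → ∑ (sentencesUpTo (size I)) (λ J → ⟦ I₂ ≟S S ⟧ * (⟦ I₁ ≟S J ⟧ * k J)))
      ≡⟨ ∑-congᴬ (cut-size I) (λ (I₁ , I₂) e → trans
           (sym (∑-*ˡ ⟦ I₂ ≟S S ⟧ (sentencesUpTo (size I)) _))
           (cong (⟦ I₂ ≟S S ⟧ *_) (∑-select-once _≟S_ {I₁} (sentencesUpTo (size I)) k
             (∑-sentencesUpTo {I₁} (ℕₚ.m+n≤o⇒m≤o (size I₁) (ℕₚ.≤-reflexive e)))))) ⟩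
    ∑ (cut I) (λ (I₁ , I₂) → ⟦ I₂ ≟S S ⟧ * k I₁) ∎

  -- Pairing with functionals

  ⟪_,_⟫ : NSym {n} → (Sentence {n} → ℚ) → ℚ
  ⟪ f , h ⟫ = ∑ f (λ (c , I) → c * h I)

  coeff-⟪⟫ : ∀ f I → coeff f I ≡ ⟪ f , (λ J → ⟦ J ≟S I ⟧) ⟫
  coeff-⟪⟫ []            I = refl
  coeff-⟪⟫ ((c , J) ∷ f) I with J ≟S I
  ... | yes _ = cong₂ _+_ (sym (*-identityʳ c)) (coeff-⟪⟫ f I)
  ... | no _  = trans (coeff-⟪⟫ f I) (sym (trans (cong (_+ ⟪ f , (λ J → ⟦ J ≟S I ⟧) ⟫) (*-zeroʳ c)) (+-identityˡ _)))

  ⟪⟫-sumᴺ : ∀ fs h → ⟪ sumᴺ fs , h ⟫ ≡ ∑ fs (λ f → ⟪ f , h ⟫)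
  ⟪⟫-sumᴺ []       h = refl
  ⟪⟫-sumᴺ (f ∷ fs) h = trans (∑-++ f (sumᴺ fs) _) (cong (⟪ f , h ⟫ +_) (⟪⟫-sumᴺ fs h))

  ⟪⟫-scale : ∀ a f h → ⟪ scale a f , h ⟫ ≡ a * ⟪ f , h ⟫
  ⟪⟫-scale a []            h = sym (*-zeroʳ a)
  ⟪⟫-scale a ((c , I) ∷ f) h = trans (cong₂ _+_ (*-assoc a c (h I)) (⟪⟫-scale a f h)) (sym (*-distribˡ-+ a (c * h I) _))

  ⟪⟫-H-*ᴺ : ∀ I g h → ⟪ H I *ᴺ g , h ⟫ ≡ ⟪ g , (λ J → h (I ++ J)) ⟫
  ⟪⟫-H-*ᴺ I []            h = refl
  ⟪⟫-H-*ᴺ I ((c , J) ∷ g) h = cong₂ _+_ (cong (_* h (I ++ J)) (*-identityˡ c)) (⟪⟫-H-*ᴺ I g h)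

  ⟪⟫-*ᴺ-H : ∀ f I h → ⟪ f *ᴺ H I , h ⟫ ≡ ⟪ f , (λ J → h (J ++ I)) ⟫
  ⟪⟫-*ᴺ-H []            I h = refl
  ⟪⟫-*ᴺ-H ((c , J) ∷ f) I h = cong₂ _+_ (cong (_* h (J ++ I)) (*-identityʳ c)) (⟪⟫-*ᴺ-H f I h)

  -- In terms of the coproduct, M_S^{⊥r}(f) = Σ ⟨f₂, M_S⟩ f₁.
  ⟪⟫-perpR : ∀ S f h →
    ⟪ perpR S f , h ⟫ ≡ ⟪ f , (λ I → ∑ (cut I) (λ (I₁ , I₂) → ⟦ I₂ ≟S S ⟧ * h I₁)) ⟫
  ⟪⟫-perpR S []            h = refl
  ⟪⟫-perpR S ((c , I) ∷ f) h = trans (∑-++ (map (λ J → c * pairHMM I J S , J) (sentencesUpTo (size I))) (perpR S f) (λ (c , J) → c * h J))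
    (cong₂ _+_
      (trans (∑-map (λ J → c * pairHMM I J S , J) (sentencesUpTo (size I)) (λ (c , J) → c * h J))
        (trans (∑-cong (sentencesUpTo (size I)) (λ J → *-assoc c (pairHMM I J S) (h J)))
          (trans (sym (∑-*ˡ c (sentencesUpTo (size I)) _)) (cong (c *_) (∑-pairHMM I S h)))))
      (⟪⟫-perpR S f h))

  size≤degBound : ∀ (f : NSym {n}) → All (λ (_ , I) → size I ≤ degBound f) f
  size≤degBound []            = []
  size≤degBound ((c , I) ∷ f) = ℕₚ.m≤m⊔n (size I) (degBound f) ∷
    All.map (λ le → ℕₚ.≤-trans le (ℕₚ.m≤n⊔m (size I) (degBound f))) (size≤degBound f)

  -- Where the indicators do not vanish, `P` and `R` are reverses of each other, so the sign can
  -- pass to `R`.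
  sgn-⟦⟧ : ∀ P R → sgn (reverse P) * ⟦ reverse P ≟S R ⟧ ≡ sgn R * ⟦ reverse R ≟S P ⟧
  sgn-⟦⟧ P R with reverse P ≟S R
  ... | yes refl = cong (sgn (reverse P) *_) (sym (⟦⟧-yes (reverse (reverse P) ≟S P) (List.reverse-involutive P)))
  ... | no  P≢R  = trans (*-zeroʳ (sgn (reverse P))) (sym (trans
    (cong (sgn R *_) (⟦⟧-no (reverse R ≟S P) (λ { refl → P≢R (List.reverse-involutive R) }))) (*-zeroʳ (sgn R))))

  -- The sum over `S` ⪰ `Q` only tests whether `Q` refines `I₂`; the adjunction turns this test into
  -- a sum over the refinements `R` of `I₂`.
  ∑-perps : ∀ I P (k : Sentence {n} → ℚ) →
    sgn (reverse P) * ∑ (coarsenings (reverse P)) (λ S → ∑ (cut I) (λ (I₁ , I₂) → ⟦ I₂ ≟S S ⟧ * k I₁)) ≡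
    ∑ (cut I) (λ (I₁ , I₂) → ∑ (refine I₂) (λ R → ⟦ reverse R ≟S P ⟧ * (sgn R * k I₁)))
  ∑-perps I P k = begin
    sgn Q * ∑ (coarsenings Q) (λ S → ∑ (cut I) (λ (I₁ , I₂) → ⟦ I₂ ≟S S ⟧ * k I₁))
      ≡⟨ cong (sgn Q *_) (∑-swap (coarsenings Q) (cut I) _) ⟩
    sgn Q * ∑ (cut I) (λ (I₁ , I₂) → ∑ (coarsenings Q) (λ S → ⟦ I₂ ≟S S ⟧ * k I₁))
      ≡⟨ ∑-*ˡ (sgn Q) (cut I) _ ⟩
    ∑ (cut I) (λ (I₁ , I₂) → sgn Q * ∑ (coarsenings Q) (λ S → ⟦ I₂ ≟S S ⟧ * k I₁))
      ≡⟨ ∑-cong (cut I) (λ (I₁ , I₂) → cong (sgn Q *_) (trans (sym (∑-*ʳ (k I₁) (coarsenings Q) _))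
           (trans (cong (_* k I₁) (∑-coarsenings-refine I₂ Q)) (∑-*ʳ (k I₁) (refine I₂) _)))) ⟩
    ∑ (cut I) (λ (I₁ , I₂) → sgn Q * ∑ (refine I₂) (λ R → ⟦ Q ≟S R ⟧ * k I₁))
      ≡⟨ ∑-cong (cut I) (λ (I₁ , I₂) → trans (∑-*ˡ (sgn Q) (refine I₂) _) (∑-cong (refine I₂) (λ R → term I₁ R))) ⟩
    ∑ (cut I) (λ (I₁ , I₂) → ∑ (refine I₂) (λ R → ⟦ reverse R ≟S P ⟧ * (sgn R * k I₁))) ∎
    where
    Q : Sentence {n}
    Q = reverse P
    term : ∀ I₁ R → sgn Q * (⟦ Q ≟S R ⟧ * k I₁) ≡ ⟦ reverse R ≟S P ⟧ * (sgn R * k I₁)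
    term I₁ R = begin
      sgn Q * (⟦ Q ≟S R ⟧ * k I₁)             ≡⟨ sym (*-assoc (sgn Q) ⟦ Q ≟S R ⟧ (k I₁)) ⟩
      sgn Q * ⟦ Q ≟S R ⟧ * k I₁               ≡⟨ cong (_* k I₁) (sgn-⟦⟧ P R) ⟩
      sgn R * ⟦ reverse R ≟S P ⟧ * k I₁       ≡⟨ solve 3 (λ a b c → a :* b :* c := b :* (a :* c)) refl
                                                   (sgn R) ⟦ reverse R ≟S P ⟧ (k I₁) ⟩
      ⟦ reverse R ≟S P ⟧ * (sgn R * k I₁)     ∎

  -- Only `u = revcat R` has `reverse R` among its factorizations, and only once; the size
  -- hypothesis keeps this `u` in range.
  ∑-words-factorizations : ∀ {N} R (k : Word {n} → ℚ) → size R ≤ N →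
    ∑ (wordsUpTo N) (λ u → ∑ (factorizations u) (λ P → ⟦ reverse R ≟S P ⟧ * k u)) ≡ k (revcat R)
  ∑-words-factorizations {N} R k le = begin
    ∑ (wordsUpTo N) (λ u → ∑ (factorizations u) (λ P → ⟦ reverse R ≟S P ⟧ * k u))
      ≡⟨ ∑-cong (wordsUpTo N) (λ u → trans (sym (∑-*ʳ (k u) (factorizations u) _)) (cong (_* k u) (trans
           (∑-factorizations (reverse R) u) (cong (λ x → ⟦ x ≟W u ⟧) (flat-reverse R))))) ⟩
    ∑ (wordsUpTo N) (λ u → ⟦ revcat R ≟W u ⟧ * k u)
      ≡⟨ ∑-select-once _≟W_ {revcat R} (wordsUpTo N) k
           (∑-wordsUpTo {revcat R} (ℕₚ.≤-trans (ℕₚ.≤-reflexive (length-revcat R)) le)) ⟩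
    k (revcat R) ∎

  ∑-twist : ∀ {N} I (k : Sentence {n} → Word {n} → ℚ) → size I ≤ N →
    ∑ (wordsUpTo N) (λ u → ∑ (factorizations u) (λ P → sgn (reverse P) *
      ∑ (coarsenings (reverse P)) (λ S → ∑ (cut I) (λ (I₁ , I₂) → ⟦ I₂ ≟S S ⟧ * k I₁ u)))) ≡ twist I k
  ∑-twist {N} I k le = begin
    ∑ (wordsUpTo N) (λ u → ∑ (factorizations u) (λ P → sgn (reverse P) *
      ∑ (coarsenings (reverse P)) (λ S → ∑ (cut I) (λ (I₁ , I₂) → ⟦ I₂ ≟S S ⟧ * k I₁ u))))
      ≡⟨ ∑-cong (wordsUpTo N) (λ u → trans
           (∑-cong (factorizations u) (λ P → ∑-perps I P (λ K → k K u)))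
           (trans (∑-swap (factorizations u) (cut I) _)
             (∑-cong (cut I) (λ (I₁ , I₂) → ∑-swap (factorizations u) (refine I₂) _)))) ⟩
    ∑ (wordsUpTo N) (λ u → ∑ (cut I) (λ (I₁ , I₂) → ∑ (refine I₂) (λ R → ∑ (factorizations u) (λ P →
      ⟦ reverse R ≟S P ⟧ * (sgn R * k I₁ u)))))
      ≡⟨ trans (∑-swap (wordsUpTo N) (cut I) _)
           (∑-cong (cut I) (λ (I₁ , I₂) → ∑-swap (wordsUpTo N) (refine I₂) _)) ⟩
    ∑ (cut I) (λ (I₁ , I₂) → ∑ (refine I₂) (λ R → ∑ (wordsUpTo N) (λ u → ∑ (factorizations u) (λ P →
      ⟦ reverse R ≟S P ⟧ * (sgn R * k I₁ u)))))
      -- The refinement `R` has as many letters as `I₂`, which has at most as many as `I`.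
      ≡⟨ ∑-congᴬ (cut-size I) (λ (I₁ , I₂) e → ∑-congᴬ (refine-size I₂) (λ R e′ →
           ∑-words-factorizations R (λ u → sgn R * k I₁ u) (ℕₚ.≤-trans (ℕₚ.≤-reflexive e′)
             (ℕₚ.≤-trans (ℕₚ.m+n≤o⇒n≤o (size I₁) (ℕₚ.≤-reflexive e)) le)))) ⟩
    twist I k ∎

  ⟪⟫-𝔹 : ∀ v f h → ⟪ 𝔹 v f , h ⟫ ≡ ⟪ f , bernstein v h ⟫
  ⟪⟫-𝔹 v f h = begin
    ⟪ 𝔹 v f , h ⟫
      ≡⟨ ⟪⟫-sumᴺ (concatMap (λ u → map (λ Q → summand u Q) (map reverse (factorizations u))) (wordsUpTo N)) h ⟩
    ∑ (concatMap (λ u → map (λ Q → summand u Q) (map reverse (factorizations u))) (wordsUpTo N)) (λ g → ⟪ g , h ⟫)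
      ≡⟨ trans (∑-concatMap (λ u → map (λ Q → summand u Q) (map reverse (factorizations u))) (wordsUpTo N) (λ g → ⟪ g , h ⟫))
           (∑-cong (wordsUpTo N) (λ u → trans (∑-map (summand u) (map reverse (factorizations u)) (λ g → ⟪ g , h ⟫))
             (∑-map reverse (factorizations u) _))) ⟩
    ∑ (wordsUpTo N) (λ u → ∑ (factorizations u) (λ P → ⟪ summand u (reverse P) , h ⟫))
      ≡⟨ ∑-cong (wordsUpTo N) (λ u → trans (∑-cong (factorizations u) (λ P → ⟪⟫-summand u (reverse P)))
           (∑-swap (factorizations u) f _)) ⟩
    ∑ (wordsUpTo N) (λ u → ∑ f (λ (c , I) → ∑ (factorizations u) (λ P → c * term I u (reverse P))))
      ≡⟨ trans (∑-swap (wordsUpTo N) f _) (∑-cong f (λ (c , I) → trans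
           (∑-cong (wordsUpTo N) (λ u → sym (∑-*ˡ c (factorizations u) _))) (sym (∑-*ˡ c (wordsUpTo N) _)))) ⟩
    ∑ f (λ (c , I) → c * ∑ (wordsUpTo N) (λ u → ∑ (factorizations u) (λ P → term I u (reverse P))))
      -- `degBound f` bounds every sentence in `f` at once, so after the sums are exchanged it
      -- serves for each `I` separately.
      ≡⟨ ∑-congᴬ (size≤degBound f) (λ (c , I) le → cong (c *_) (∑-twist I (λ K u → h ((v ⁺++ u) ∷ K)) le)) ⟩
    ⟪ f , bernstein v h ⟫ ∎
    where
    N : ℕ
    N = degBound f
    summand : Word {n} → Sentence {n} → NSym {n}
    summand u Q = scale (sgn Q) (H ((v ⁺++ u) ∷ []) *ᴺ sumᴺ (map (λ S → perpR S f) (coarsenings Q)))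
    term : Sentence {n} → Word {n} → Sentence {n} → ℚ
    term I u Q = sgn Q * ∑ (coarsenings Q) (λ S → ∑ (cut I) (λ (I₁ , I₂) → ⟦ I₂ ≟S S ⟧ * h ((v ⁺++ u) ∷ I₁)))
    ⟪⟫-summand : ∀ u Q → ⟪ summand u Q , h ⟫ ≡ ∑ f (λ (c , I) → c * term I u Q)
    ⟪⟫-summand u Q = begin
      ⟪ summand u Q , h ⟫
        ≡⟨ trans (⟪⟫-scale (sgn Q) (H ((v ⁺++ u) ∷ []) *ᴺ perps) h)
             (cong (sgn Q *_) (⟪⟫-H-*ᴺ ((v ⁺++ u) ∷ []) perps h)) ⟩
      sgn Q * ⟪ perps , (λ K → h ((v ⁺++ u) ∷ K)) ⟫
        ≡⟨ cong (sgn Q *_) (trans (⟪⟫-sumᴺ (map (λ S → perpR S f) (coarsenings Q)) (λ K → h ((v ⁺++ u) ∷ K)))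
             (trans (∑-map (λ S → perpR S f) (coarsenings Q) (λ g → ⟪ g , (λ K → h ((v ⁺++ u) ∷ K)) ⟫))
               (∑-cong (coarsenings Q) (λ S → ⟪⟫-perpR S f (λ K → h ((v ⁺++ u) ∷ K)))))) ⟩
      sgn Q * ∑ (coarsenings Q) (λ S → ∑ f (λ (c , I) → c * inner I S))
        ≡⟨ cong (sgn Q *_) (trans (∑-swap (coarsenings Q) f _)
             (∑-cong f (λ (c , I) → sym (∑-*ˡ c (coarsenings Q) (inner I))))) ⟩
      sgn Q * ∑ f (λ (c , I) → c * ∑ (coarsenings Q) (inner I))
        ≡⟨ trans (∑-*ˡ (sgn Q) f _) (∑-cong f (λ (c , I) →
             solve 3 (λ a b c → a :* (b :* c) := b :* (a :* c)) refl (sgn Q) c (∑ (coarsenings Q) (inner I)))) ⟩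
      ∑ f (λ (c , I) → c * term I u Q) ∎
      where
      perps : NSym {n}
      perps = sumᴺ (map (λ S → perpR S f) (coarsenings Q))
      inner : Sentence {n} → Sentence {n} → ℚ
      inner I S = ∑ (cut I) (λ (I₁ , I₂) → ⟦ I₂ ≟S S ⟧ * h ((v ⁺++ u) ∷ I₁))

  -- The Pieri rule

  -- Since w = q_g⋯q_1, the word q_1 attached to the first entry is the suffix `y`, and the prefix
  -- `x` is passed on. What reaches the end becomes u_{h+1}, or no word at all if it is empty.
  pieri : Sentence {n} → Word {n} → List (Sentence {n})
  pieri []      w = word w ∷ []
  pieri (v ∷ J) w = concatMap (λ (x , y) → map ((v ⁺++ y) ∷_) (pieri J x)) (splits w)

  ∑-pieri-∷ : ∀ v J w (G : Sentence {n} → ℚ) →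
    ∑ (pieri (v ∷ J) w) G ≡ ∑ (splits w) (λ (x , y) → ∑ (pieri J x) (λ K → G ((v ⁺++ y) ∷ K)))
  ∑-pieri-∷ v J w G = trans (∑-concatMap (λ (x , y) → map ((v ⁺++ y) ∷_) (pieri J x)) (splits w) G)
    (∑-cong (splits w) (λ (x , y) → ∑-map ((v ⁺++ y) ∷_) (pieri J x) G))

  ⟪⟫-oneᴺ : ∀ h → ⟪ oneᴺ , h ⟫ ≡ h []
  ⟪⟫-oneᴺ h = trans (+-identityʳ _) (*-identityˡ (h []))

  ⁺++-identityʳ : (v : NWord {n}) → (v ⁺++ []) ≡ v
  ⁺++-identityʳ (c ∷ cs) = cong (c ∷_) (List.++-identityʳ cs)

  -- 𝔖_{(w)} = H_w, because only the empty `u` contributes to 𝔹_w(1).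
  ⟪⟫-𝔖-word : ∀ w h → ⟪ 𝔖 (word w) , h ⟫ ≡ h (word w)
  ⟪⟫-𝔖-word []       h = ⟪⟫-oneᴺ h
  ⟪⟫-𝔖-word (c ∷ cs) h = begin
    ⟪ 𝔹 (c ∷ cs) oneᴺ , h ⟫        ≡⟨ ⟪⟫-𝔹 (c ∷ cs) oneᴺ h ⟩
    ⟪ oneᴺ , bernstein (c ∷ cs) h ⟫ ≡⟨ ⟪⟫-oneᴺ (bernstein (c ∷ cs) h) ⟩
    1ℚ * h (((c ∷ cs) ⁺++ []) ∷ []) + 0ℚ + 0ℚ
      ≡⟨ solve 1 (λ a → con 1ℚ :* a :+ con 0ℚ :+ con 0ℚ := a) refl (h (((c ∷ cs) ⁺++ []) ∷ [])) ⟩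
    h (((c ∷ cs) ⁺++ []) ∷ [])      ≡⟨ cong (λ v → h (v ∷ [])) (⁺++-identityʳ (c ∷ cs)) ⟩
    h ((c ∷ cs) ∷ [])               ∎

  -- The induction on `J` is uniform in `w` and `h`: the hypothesis is used for every prefix `x` and
  -- for the functional `bernstein (v ⁺++ y) h`.
  ⟪⟫-𝔖-*ᴺ-H : ∀ J w h → ⟪ 𝔖 J *ᴺ H (word w) , h ⟫ ≡ ∑ (pieri J w) (λ K → ⟪ 𝔖 K , h ⟫)
  ⟪⟫-𝔖-*ᴺ-H [] w h = begin
    ⟪ oneᴺ *ᴺ H (word w) , h ⟫       ≡⟨ ⟪⟫-*ᴺ-H oneᴺ (word w) h ⟩
    ⟪ oneᴺ , (λ I → h (I ++ word w)) ⟫ ≡⟨ ⟪⟫-oneᴺ (λ I → h (I ++ word w)) ⟩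
    h (word w)                        ≡⟨ sym (⟪⟫-𝔖-word w h) ⟩
    ⟪ 𝔖 (word w) , h ⟫               ≡⟨ sym (+-identityʳ _) ⟩
    ⟪ 𝔖 (word w) , h ⟫ + 0ℚ          ∎
  ⟪⟫-𝔖-*ᴺ-H (v ∷ J) w h = begin
    ⟪ 𝔹 v (𝔖 J) *ᴺ H (word w) , h ⟫
      ≡⟨ trans (⟪⟫-*ᴺ-H (𝔹 v (𝔖 J)) (word w) h) (⟪⟫-𝔹 v (𝔖 J) (λ K → h (K ++ word w))) ⟩
    ⟪ 𝔖 J , bernstein v (λ K → h (K ++ word w)) ⟫
      ≡⟨ ∑-cong (𝔖 J) (λ (c , I) → trans (cong (c *_) (bernstein-++-word v h I w)) (∑-*ˡ c (splits w) _)) ⟩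
    ∑ (𝔖 J) (λ (c , I) → ∑ (splits w) (λ (x , y) → c * bernstein (v ⁺++ y) h (I ++ word x)))
      ≡⟨ ∑-swap (𝔖 J) (splits w) _ ⟩
    ∑ (splits w) (λ (x , y) → ⟪ 𝔖 J , (λ I → bernstein (v ⁺++ y) h (I ++ word x)) ⟫)
      ≡⟨ ∑-cong (splits w) (λ (x , y) → trans
           (sym (⟪⟫-*ᴺ-H (𝔖 J) (word x) (bernstein (v ⁺++ y) h))) (⟪⟫-𝔖-*ᴺ-H J x (bernstein (v ⁺++ y) h))) ⟩
    ∑ (splits w) (λ (x , y) → ∑ (pieri J x) (λ K → ⟪ 𝔖 K , bernstein (v ⁺++ y) h ⟫))
      ≡⟨ ∑-cong (splits w) (λ (x , y) → ∑-cong (pieri J x) (λ K → sym (⟪⟫-𝔹 (v ⁺++ y) (𝔖 K) h))) ⟩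
    ∑ (splits w) (λ (x , y) → ∑ (pieri J x) (λ K → ⟪ 𝔖 ((v ⁺++ y) ∷ K) , h ⟫))
      ≡⟨ sym (∑-pieri-∷ v J w (λ K → ⟪ 𝔖 K , h ⟫)) ⟩
    ∑ (pieri (v ∷ J) w) (λ K → ⟪ 𝔖 K , h ⟫) ∎

  -- The index set of the Pieri rule

  pieri-size : ∀ J w → All (λ K → size K ≡ size J ℕ.+ length w) (pieri J w)
  pieri-size []      w = size-word w ∷ []
  pieri-size (v ∷ J) w = All.concat⁺ (All.map⁺ (All.map (λ {s} e → All.map⁺ (All.map (λ {K} → step s e K) (pieri-size J (proj₁ s))))
    (splits-++ w)))
    where
    step : ∀ ((x , y) : Word {n} × Word {n}) → x ++ y ≡ w → ∀ K → size K ≡ size J ℕ.+ length x →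
      size ((v ⁺++ y) ∷ K) ≡ size (v ∷ J) ℕ.+ length w
    step (x , y) e K e′ = begin
      suc (length (List⁺.tail v ++ y)) ℕ.+ size K
        ≡⟨ cong₂ (λ a b → suc a ℕ.+ b) (List.length-++ (List⁺.tail v)) (trans e′ (ℕₚ.+-comm (size J) (length x))) ⟩
      (List⁺.length v ℕ.+ length y) ℕ.+ (length x ℕ.+ size J)
        ≡⟨ cong (List⁺.length v ℕ.+ length y ℕ.+_) (ℕₚ.+-comm (length x) (size J)) ⟩
      (List⁺.length v ℕ.+ length y) ℕ.+ (size J ℕ.+ length x)
        ≡⟨ interchange (List⁺.length v) (length y) (size J) (length x) ⟩
      size (v ∷ J) ℕ.+ (length y ℕ.+ length x)
        ≡⟨ cong (size (v ∷ J) ℕ.+_) (trans (ℕₚ.+-comm (length y) (length x)) (trans (sym (List.length-++ x)) (cong length e))) ⟩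
      size (v ∷ J) ℕ.+ length w ∎

  splits-distinct : ∀ w → AllPairs (λ s t → proj₂ s ≢ proj₂ t) (splits w)
  splits-distinct []       = [] ∷ []
  splits-distinct (c ∷ cs) = All.map⁺ (All.map longer (splits-++ cs)) ∷ AllPairs.map⁺ (splits-distinct cs)
    where
    longer : ∀ {s} → proj₁ s ++ proj₂ s ≡ cs → c ∷ cs ≢ proj₂ s
    longer {x , _} e refl = ℕₚ.1+n≰n (ℕₚ.≤-trans (ℕₚ.m≤n+m (suc (length cs)) (length x))
      (ℕₚ.≤-reflexive (trans (sym (List.length-++ x)) (cong length e))))

  -- The first word `v ⁺++ y` determines `y`, and different splittings of `w` have different
  -- suffixes, so their blocks are disjoint.
  pieri-Unique : ∀ J w → Unique (pieri J w)
  pieri-Unique []      w = [] ∷ []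
  pieri-Unique (v ∷ J) w = Unique.concat⁺
    (All.map⁺ (All.universal (λ (x , y) → Unique.map⁺ List.∷-injectiveʳ (pieri-Unique J x)) (splits w)))
    (AllPairs.map⁺ (AllPairs.map disjoint (splits-distinct w)))
    where
    disjoint : ∀ {s t : Word {n} × Word {n}} → proj₂ s ≢ proj₂ t →
      Disjoint (map ((v ⁺++ proj₂ s) ∷_) (pieri J (proj₁ s))) (map ((v ⁺++ proj₂ t) ∷_) (pieri J (proj₁ t)))
    disjoint ≢ (p , q) with ∈-map⁻ _ p | ∈-map⁻ _ q
    ... | _ , _ , refl | _ , _ , e = ≢ (List.++-cancelˡ (List⁺.tail v) _ _ (cong List⁺.tail (List.∷-injectiveˡ e)))

  ∈-splits : ∀ x y → (x , y) ∈ splits (x ++ y)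
  ∈-splits []       []       = here refl
  ∈-splits []       (c ∷ cs) = here refl
  ∈-splits (c ∷ cs) y        = there (∈-map⁺ (map₁ (c ∷_)) (∈-splits cs y))

-- Identifying the splittings inside `splitsInto`

-- `F`, `G` and `sp` stand for the anonymous and local functions inside `splitsInto`, which are
-- compared pointwise with their counterparts here.
map-splits : {n : ℕ} {A : Set} {F F′ : Word {n} × Word {n} → A} {G G′ : Word {n} × Word {n} → Word {n} × Word {n}}
  {sp : Word {n} → List (Word {n} × Word {n})} (w : Word {n}) →
  (∀ w → sp w ≡ splits w) → (∀ p → F p ≡ F′ p) → (∀ p → G p ≡ G′ p) →
  map F (map G (sp w)) ≡ map F′ (map G′ (splits w))
map-splits {F′ = F′} {G′ = G′} w e F≗F′ G≗G′ = trans (List.map-cong F≗F′ _)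
  (cong (map F′) (trans (List.map-cong G≗G′ _) (cong (map G′) (e w))))

splits-unique : {n : ℕ} (sp : Word {n} → List (Word {n} × Word {n})) → sp [] ≡ ([] , []) ∷ [] →
  (∀ c cs → sp (c ∷ cs) ≡ ([] , c ∷ cs) ∷ map (map₁ (c ∷_)) (sp cs)) → ∀ w → sp w ≡ splits w
splits-unique sp e₀ e₁ []       = e₀
splits-unique sp e₀ e₁ (c ∷ cs) =
  trans (e₁ c cs) (cong (λ l → ([] , c ∷ cs) ∷ map (map₁ (c ∷_)) l) (splits-unique sp e₀ e₁ cs))

-- splitsInto splits its word with a local function that cannot be named here; localSplits is
-- that function, found by unification. The abstraction of foldr makes the unification
-- problem solvable, that of c ∷ cs separates the two word arguments of the local function.
mutual
  localSplits : {n : ℕ} → ℕ → Word {n} → Word {n} → List (Word {n} × Word {n})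
  localSplits = _

  splitsInto-suc : {n : ℕ} (g : ℕ) (w : Word {n}) →
    splitsInto (suc g) w ≡ concatMap (λ (p , s) → map (p ∷_) (splitsInto g s)) (splits w)
  splitsInto-suc g []       = refl
  splitsInto-suc {n} g (c ∷ cs) with Word {n} ∋ c ∷ cs | foldr (_++_ {A = List (Word {n})}) []
  ... | w | join = cong (λ l → _ ++ join l) (map-splits {sp = localSplits g w} cs
    (splits-unique (localSplits g w) refl (λ _ _ → refl)) (λ _ → refl) (λ _ → refl))

-- The recursive index set agrees with the Pieri condition

module _ {n : ℕ} where

  ∈-splitsInto⁺ : ∀ (ps : List (Word {n})) → ps ∈ splitsInto (length ps) (concat ps)
  ∈-splitsInto⁺ []       = here refl
  ∈-splitsInto⁺ (p ∷ ps) = subst ((p ∷ ps) ∈_) (sym (splitsInto-suc (length ps) (p ++ concat ps)))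
    (∈-concatMap⁺ _ (lose (∈-splits p (concat ps)) (∈-map⁺ (p ∷_) (∈-splitsInto⁺ ps))))

  ∈-splitsInto⁻ : ∀ g w {ps : List (Word {n})} → ps ∈ splitsInto g w → concat ps ≡ w
  ∈-splitsInto⁻ zero    []      (here refl) = refl
  ∈-splitsInto⁻ (suc g) w       ps∈
    with find (∈-concatMap⁻ _ {xs = splits w} (subst (_ ∈_) (splitsInto-suc g w) ps∈))
  ... | (p , s) , ps∈splits , ps∈map with ∈-map⁻ (p ∷_) ps∈map
  ...   | ps′ , ps′∈ , refl = trans (cong (p ++_) (∈-splitsInto⁻ g s ps′∈)) (All.lookup (splits-++ w) ps∈splits)

  concat-reverse-∷ : ∀ (q : Word {n}) qs → concat (reverse (q ∷ qs)) ≡ concat (reverse qs) ++ q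
  concat-reverse-∷ q qs = begin
    concat (reverse (q ∷ qs))         ≡⟨ cong concat (List.unfold-reverse q qs) ⟩
    concat (reverse qs ++ q ∷ [])     ≡⟨ sym (List.concat-++ (reverse qs) (q ∷ [])) ⟩
    concat (reverse qs) ++ (q ++ [])  ≡⟨ cong (concat (reverse qs) ++_) (List.++-identityʳ q) ⟩
    concat (reverse qs) ++ q          ∎

  build⇒∈pieri : ∀ (J : Sentence {n}) qs {K} → build J qs ≡ just K → K ∈ pieri J (concat (reverse qs))
  build⇒∈pieri []      []             refl = here refl
  build⇒∈pieri []      ((c ∷ cs) ∷ []) refl = here (cong (λ cs → (c ∷ cs) ∷ []) (sym (List.++-identityʳ cs)))
  build⇒∈pieri (v ∷ J) (q ∷ qs)       e with build J qs in eq
  build⇒∈pieri (v ∷ J) (q ∷ qs)       refl | just K = subst (λ w → ((v ⁺++ q) ∷ K) ∈ pieri (v ∷ J) w)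
    (sym (concat-reverse-∷ q qs))
    (∈-concatMap⁺ _ (lose (∈-splits (concat (reverse qs)) q) (∈-map⁺ ((v ⁺++ q) ∷_) (build⇒∈pieri J qs eq))))

  ∈pieri⇒build : ∀ (J : Sentence {n}) w {K} → K ∈ pieri J w → ∃[ qs ] build {n} J qs ≡ just K × concat (reverse qs) ≡ w
  ∈pieri⇒build []      []       (here refl) = [] , refl , refl
  ∈pieri⇒build []      (c ∷ cs) (here refl) = (c ∷ cs) ∷ [] , refl , List.++-identityʳ (c ∷ cs)
  ∈pieri⇒build (v ∷ J) w        K∈ with find (∈-concatMap⁻ _ {xs = splits w} K∈)
  ... | (x , y) , xy∈ , K∈map with ∈-map⁻ ((v ⁺++ y) ∷_) K∈map
  ...   | K′ , K′∈ , refl with ∈pieri⇒build J x K′∈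
  ...     | qs , e , e′ = y ∷ qs , cong (Maybe.map ((v ⁺++ y) ∷_)) e ,
    trans (concat-reverse-∷ y qs) (trans (cong (_++ y) e′) (All.lookup (splits-++ w) xy∈))

  -- `build` itself forces g to be h or h+1, so the two families in `admissibleQs` miss no tuple.
  build-length : ∀ J qs {K : Sentence {n}} → build J qs ≡ just K → length qs ≡ ℓ J ⊎ length qs ≡ suc (ℓ J)
  build-length []      []       e = inj₁ refl
  build-length []      (_ ∷ []) e = inj₂ refl
  build-length (v ∷ J) (q ∷ qs) e with build J qs in eq
  ... | just K = Sum.map (cong suc) (cong suc) (build-length J qs eq)

  ∈-qTuples⁺ : ∀ (qs : List (Word {n})) → qs ∈ qTuples (length qs) (concat (reverse qs))
  ∈-qTuples⁺ qs = subst₂ (λ g rs → rs ∈ qTuples g (concat (reverse qs))) (List.length-reverse qs)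
    (List.reverse-involutive qs) (∈-map⁺ reverse (∈-splitsInto⁺ (reverse qs)))

  ∈-qTuples⁻ : ∀ g w {qs : List (Word {n})} → qs ∈ qTuples g w → concat (reverse qs) ≡ w
  ∈-qTuples⁻ g w qs∈ with ∈-map⁻ reverse qs∈
  ... | ps , ps∈ , refl = trans (cong concat (List.reverse-involutive ps)) (∈-splitsInto⁻ g w ps∈)

  IsPieri : Sentence {n} → Word {n} → Sentence {n} → Set
  IsPieri J w K = Any (λ qs → build J qs ≡ just K) (admissibleQs J w)

  IsPieri⇒∈pieri : ∀ J w K → IsPieri J w K → K ∈ pieri J w
  IsPieri⇒∈pieri J w K p with find p
  ... | qs , qs∈ , e = subst (λ w → K ∈ pieri J w)
    ([ ∈-qTuples⁻ (ℓ J) w , ∈-qTuples⁻ (suc (ℓ J)) w ] (∈-++⁻ (qTuples (ℓ J) w) qs∈)) (build⇒∈pieri J qs e)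

  ∈pieri⇒IsPieri : ∀ J w K → K ∈ pieri J w → IsPieri J w K
  ∈pieri⇒IsPieri J w K K∈ with ∈pieri⇒build J w K∈
  ... | qs , e , refl = lose (qs∈ (build-length J qs e)) e
    where
    qs∈ : length qs ≡ ℓ J ⊎ length qs ≡ suc (ℓ J) → qs ∈ admissibleQs J (concat (reverse qs))
    qs∈ (inj₁ l) = ∈-++⁺ˡ (subst (λ g → qs ∈ qTuples g (concat (reverse qs))) l (∈-qTuples⁺ qs))
    qs∈ (inj₂ l) = ∈-++⁺ʳ (qTuples (ℓ J) (concat (reverse qs))) (subst (λ g → qs ∈ qTuples g (concat (reverse qs))) l (∈-qTuples⁺ qs))

  ∑-pieriIndex : ∀ J w (F : Sentence {n} → ℚ) → ∑ (pieriIndex J w) F ≡ ∑ (pieri J (toList w)) F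
  ∑-pieriIndex J w F = begin
    ∑ (pieriIndex J w) F
      ≡⟨ ∑-filter isPieri? (sentencesOfSize m) F ⟩
    ∑ (sentencesOfSize m) (λ K → ⟦ isPieri? K ⟧ * F K)
      -- As `pieri` has no repetitions, the indicator of the filter is the multiplicity of `K` in
      -- it; after the exchange of sums each `L` is selected once from `sentencesOfSize m`.
      ≡⟨ ∑-cong (sentencesOfSize m) (λ K → trans
           (cong (_* F K) (sym (∑-Unique _≟S_ {x₀ = K} (pieri-Unique J (toList w)) (isPieri? K)
             (IsPieri⇒∈pieri J (toList w) K) (∈pieri⇒IsPieri J (toList w) K))))
           (trans (∑-*ʳ (F K) (pieri J (toList w)) _) (∑-cong (pieri J (toList w)) (λ L →
             cong (_* F K) (⟦⟧-⇔ (K ≟S L) (L ≟S K) sym sym))))) ⟩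
    ∑ (sentencesOfSize m) (λ K → ∑ (pieri J (toList w)) (λ L → ⟦ L ≟S K ⟧ * F K))
      ≡⟨ ∑-swap (sentencesOfSize m) (pieri J (toList w)) _ ⟩
    ∑ (pieri J (toList w)) (λ L → ∑ (sentencesOfSize m) (λ K → ⟦ L ≟S K ⟧ * F K))
      ≡⟨ ∑-congᴬ (pieri-size J (toList w)) (λ L e → ∑-select-once _≟S_ {L} (sentencesOfSize m) F
           (trans (∑-sentencesOfSize L m) (⟦⟧-yes (size L ℕ.≟ m) e))) ⟩
    ∑ (pieri J (toList w)) F ∎
    where
    m : ℕ
    m = size J ℕ.+ List⁺.length w
    isPieri? : Decidable (IsPieri J (toList w))
    isPieri? K = any? (λ qs → Maybe.≡-dec _≟S_ (build J qs) (just K)) (admissibleQs J (toList w))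

theorem5p10 : (n : ℕ) (J : Sentence {n}) (w : NWord {n}) →
    (𝔖 J *ᴺ H (w ∷ [])) ≈ᴺ sumᴺ (map 𝔖 (pieriIndex J w))
theorem5p10 n J w I = begin
  coeff (𝔖 J *ᴺ H (w ∷ [])) I
    ≡⟨ coeff-⟪⟫ (𝔖 J *ᴺ H (w ∷ [])) I ⟩
  ⟪ 𝔖 J *ᴺ H (w ∷ []) , δ ⟫
    -- `word (toList w)` is `w ∷ []` by definition, `w` being nonempty.
    ≡⟨ ⟪⟫-𝔖-*ᴺ-H J (toList w) δ ⟩
  ∑ (pieri J (toList w)) (λ K → ⟪ 𝔖 K , δ ⟫)
    ≡⟨ sym (∑-pieriIndex J w (λ K → ⟪ 𝔖 K , δ ⟫)) ⟩
  ∑ (pieriIndex J w) (λ K → ⟪ 𝔖 K , δ ⟫)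
    ≡⟨ sym (trans (⟪⟫-sumᴺ (map 𝔖 (pieriIndex J w)) δ) (∑-map 𝔖 (pieriIndex J w) (λ f → ⟪ f , δ ⟫))) ⟩
  ⟪ sumᴺ (map 𝔖 (pieriIndex J w)) , δ ⟫
    ≡⟨ sym (coeff-⟪⟫ (sumᴺ (map 𝔖 (pieriIndex J w))) I) ⟩
  coeff (sumᴺ (map 𝔖 (pieriIndex J w))) I ∎
  where
  δ : Sentence {n} → ℚ
  δ K = ⟦ K ≟S I ⟧
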